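{- For each integer $n\geq 1$, the tree language $\mathcal{L}_n\subseteq T^\omega_{\{0,1\}}$ is $D_{\omega^n}(\boldsymbol{\Sigma}^1_1)$-complete, and it is accepted by a (nondeterministic) Muller tree automaton.
   Context: **Trees.** For a finite alphabet $\Sigma$, $T_\Sigma^\omega$ is the set of all functions $t:\{l,r\}^\star\to\Sigma$ (infinite binary trees labelled in $\Sigma$; nodes are finite words over $\{l,r\}$, the root is the empty word $\lambda$). For $t\in T_\Sigma^\omega$ and $u\in\{l,r\}^\star$, $t_u\in T_\Sigma^\omega$ is the subtree $t_u(v)=t(u\cdot v)$. A path of $t$ is an infinite sequence $t(u_0)t(u_1)t(u_2)\cdots$ of labels along an infinite branch, where $u_0=\lambda$ and $u_{i+1}\in\{u_i l,u_i r\}$ for all $i$. **Topology.** $\Sigma^\omega$ (infinite words) and $T_\Sigma^\omega$ carry the Cantor (product of discrete) topology. $\boldsymbol{\Sigma}^1_1$ is the class of analytic sets. **Difference hierarchy.** A countable ordinal is even if it is of the form $\gamma+m$ with $\gamma$ equal to $0$ or a limit ordinal and $m$ an even non-negative integer; otherwise it is odd. For an ordinal $\eta<\omega_1$ and an increasing sequence $(A_\theta)_{\theta<\eta}$ of subsets of a space $X$, $D_\eta[(A_\theta)_{\theta<\eta}]$ is the set of $x\in X$ such that $x\in A_\theta\setminus\bigcup_{\theta'<\theta}A_{\theta'}$ for some $\theta<\eta$ whose parity is opposite to that of $\eta$. For $X=\Sigma^\omega$ or $X=T_\Sigma^\omega$, $D_\eta(\boldsymbol{\Sigma}^1_1)$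 is the class of all sets $D_\eta[(A_\theta)_{\theta<\eta}]$ with every $A_\theta\subseteq X$ in $\boldsymbol{\Sigma}^1_1$. **Reducibility and completeness.** $E\leq_W F$ (Wadge reducibility) means $E=f^{ -1}(F)$ for some continuous function $f$ between the ambient spaces. A set $F$ (in a space $\Sigma^\omega$ or $T_\Sigma^\omega$) is $D_\eta(\boldsymbol{\Sigma}^1_1)$-complete if for every finite alphabet $Y$ and every $E\subseteq Y^\omega$: $E\in D_\eta(\boldsymbol{\Sigma}^1_1)$ iff $E\leq_W F$. **The language $\mathcal{L}$.** $\mathcal{L}\subseteq T^\omega_{\{0,1\}}$ is the set of trees having at least one path in $(0^\star\cdot 1)^\omega$, i.e. at least one path containing infinitely many letters $1$. **The languages $\mathcal{L}_n$.** For non-negative integers $a_{n-1},\ldots,a_0$ write $\mathrm{Ord}(a_{n-1},\ldots,a_0)=\omega^{n-1}\cdot a_{n-1}+\cdots+\omega\cdot a_1+a_0$. For $n=1$, $$\mathcal{L}_1=\{t\in T^\omega_{\{0,1\}}\mid \exists m\geq 0\ \ t_{l^m\cdot r}\in\mathcal{L}\text{ and }\min\{m\geq 0\mid t_{l^m\cdot r}\in\mathcal{L}\}\text{ is odd}\}.$$ For $n\geq 2$, $\mathcal{L}_n$ is the set of $t\in T^\omega_{\{0,1\}}$ for which there exist integers $a_{n-1},\ldots,a_0\geq 0$ such that: (1) $t_{l^{a_{n-1}}\cdot r\cdot l^{a_{n-2}}\cdot r\cdots l^{a_0}\cdot r}\in\mathcal{L}$ and $\mathrm{Ord}(a_{n-1},\ldots,a_0)$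 is odd; (2) for all integers $b_{n-1},\ldots,b_0\ge 0$ with $\mathrm{Ord}(b_{n-1},\ldots,b_0)<\mathrm{Ord}(a_{n-1},\ldots,a_0)$, the tree $t_{l^{b_{n-1}}\cdot r\cdot l^{b_{n-2}}\cdot r\cdots l^{b_0}\cdot r}$ is not in $\mathcal{L}$. **Muller tree automata.** A Muller tree automaton is a tuple $\mathcal{A}=(K,\Sigma,\Delta,q_0,\mathcal{F})$ with $K$ a finite set of states, $\Sigma$ a finite alphabet, $\Delta\subseteq K\times\Sigma\times K\times K$, $q_0\in K$, $\mathcal{F}\subseteq 2^K$. A run on $t\in T_\Sigma^\omega$ is a tree $\rho\in T_K^\omega$ with $\rho(\lambda)=q_0$ and $(\rho(u),t(u),\rho(u\cdot l),\rho(u\cdot r))\in\Delta$ for all $u\in\{l,r\}^\star$. It is accepting if for each path of $\rho$ the set of states appearing infinitely often on the path belongs to $\mathcal{F}$. $\mathcal{A}$ accepts the language of all trees $t$ on which it has at least one accepting run. -}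

module Defs where

open import Level using (0ℓ)
open import Data.Bool.Base using (Bool; T)
open import Data.Fin.Base using (Fin; zero; suc)
open import Data.Fin.Subset using (Subset; _∈_)
open import Data.List.Base using (List; []; _∷_; _++_; _∷ʳ_; replicate)
open import Data.List.Relation.Unary.All using (All)
open import Data.Nat.Base as ℕ using (ℕ; zero; suc; NonZero)
open import Data.Nat.Divisibility using (_∣_)
open import Data.Product.Base using (Σ-syntax; ∃; ∃-syntax; _×_; _,_)
open import Data.Sum.Base using (_⊎_)
open import Data.Vec.Base using (Vec; []; _∷_)
open import Function.Bundles using (_⇔_)
open import Relation.Binary.PropositionalEquality using (_≡_)
open import Relation.Nullary.Negation using (¬_)
open import Relation.Unary using (Pred; _⊆_; _≐_; _⊢_; ∁)

------------------------------------------------------------------------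
-- Topology

-- A set of points together with a family of basic open sets.

record Space : Set₁ where
  field
    Point : Set
    Basic : Set
    _∈ᵇ_  : Point → Basic → Set

open Space using (Point; Basic)

IsOpen : (X : Space) → Pred (Point X) 0ℓ → Set
IsOpen X U = ∀ x → U x → ∃[ b ] (x ∈ᵇ b × (∀ y → y ∈ᵇ b → U y))
  where open Space X using (_∈ᵇ_)

IsClosed : (X : Space) → Pred (Point X) 0ℓ → Set
IsClosed X C = IsOpen X (∁ C)

Continuous : (X Y : Space) → (Point X → Point Y) → Set₁
Continuous X Y f = ∀ (U : Pred (Point Y) 0ℓ) → IsOpen Y U → IsOpen X (f ⊢ U)

-- The product topology on I → A, with A discrete: a basic open set
-- prescribes the values at finitely many coordinates.

Product : Set → Set → Space
Product I A = record
  { Point = I → A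
  ; Basic = List (I × A)
  ; _∈ᵇ_  = λ x b → All (λ (i , a) → x i ≡ a) b
  }

_⊗_ : Space → Space → Space
X ⊗ Y = record
  { Point = Point X × Point Y
  ; Basic = Basic X × Basic Y
  ; _∈ᵇ_  = λ (x , y) (b , c) → Space._∈ᵇ_ X x b × Space._∈ᵇ_ Y y c
  }

Words : Set → Space
Words A = Product ℕ A

Baire : Space
Baire = Product ℕ ℕ

-- Σ¹₁ (boldface): projections of closed subsets of X × ℕ^ℕ.

Analytic : (X : Space) → Pred (Point X) 0ℓ → Set₁
Analytic X E =
  Σ[ C ∈ Pred (Point (X ⊗ Baire)) 0ℓ ]
    (IsClosed (X ⊗ Baire) C × E ≐ (λ x → ∃[ y ] C (x , y)))

WadgeReducible : (X Y : Space) → Pred (Point X) 0ℓ → Pred (Point Y) 0ℓ → Set₁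
WadgeReducible X Y E F =
  Σ[ f ∈ (Point X → Point Y) ] (Continuous X Y f × E ≐ (f ⊢ F))

------------------------------------------------------------------------
-- Countable ordinals

-- Notations for the ordinals below ω₁; `lim f` denotes the supremum of
-- the f n, which need not be increasing. A given ordinal has many
-- notations, so ordinals are compared with _≈ₒ_ and not with _≡_.

data Ordinal : Set where
  zero : Ordinal
  suc  : Ordinal → Ordinal
  lim  : (ℕ → Ordinal) → Ordinal

infix 4 _≤ₒ_ _<ₒ_ _≈ₒ_

data _≤ₒ_ : Ordinal → Ordinal → Set where
  zero≤   : ∀ {α} → zero ≤ₒ α
  suc≤suc : ∀ {α β} → α ≤ₒ β → suc α ≤ₒ suc β
  ≤lim    : ∀ {α f} n → α ≤ₒ f n → α ≤ₒ lim f
  lim≤    : ∀ {f α} → (∀ n → f n ≤ₒ α) → lim f ≤ₒ α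

_<ₒ_ : Ordinal → Ordinal → Set
α <ₒ β = suc α ≤ₒ β

_≈ₒ_ : Ordinal → Ordinal → Set
α ≈ₒ β = α ≤ₒ β × β ≤ₒ α

infixl 6 _+ₒ_
infixl 7 _·ₒ_

_+ₒ_ : Ordinal → Ordinal → Ordinal
α +ₒ zero  = α
α +ₒ suc β = suc (α +ₒ β)
α +ₒ lim f = lim (λ n → α +ₒ f n)

_·ₒ_ : Ordinal → Ordinal → Ordinal
α ·ₒ zero  = zero
α ·ₒ suc β = α ·ₒ β +ₒ α
α ·ₒ lim f = lim (λ n → α ·ₒ f n)

fromℕ : ℕ → Ordinal
fromℕ zero    = zero
fromℕ (suc n) = suc (fromℕ n)

ω : Ordinal
ω = lim fromℕ

ω^_ : ℕ → Ordinal
ω^ zero    = fromℕ 1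
ω^ (suc n) = (ω^ n) ·ₒ ω

IsLimit : Ordinal → Set
IsLimit γ = zero <ₒ γ × (∀ β → β <ₒ γ → suc β <ₒ γ)

Even : Ordinal → Set
Even α = ∃[ γ ] ∃[ m ] ((γ ≈ₒ zero ⊎ IsLimit γ) × 2 ∣ m × α ≈ₒ γ +ₒ fromℕ m)

Odd : Ordinal → Set
Odd α = ¬ Even α

OppositeParity : Ordinal → Ordinal → Set
OppositeParity α β = (Even α × Odd β) ⊎ (Odd α × Even β)

------------------------------------------------------------------------
-- Difference hierarchy over the analytic sets

-- A sequence (A_θ)_{θ<η} is given by a family on all notations, of which
-- only the members with θ < η matter. Monotonicity with respect to _≤ₒ_
-- makes A_θ independent of the notation chosen for θ.

Increasing : {X : Set} → Ordinal → (Ordinal → Pred X 0ℓ) → Set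
Increasing η A = ∀ θ θ′ → θ ≤ₒ θ′ → θ′ <ₒ η → A θ ⊆ A θ′

D : {X : Set} → Ordinal → (Ordinal → Pred X 0ℓ) → Pred X 0ℓ
D η A x =
  ∃[ θ ] (θ <ₒ η × A θ x × (∀ θ′ → θ′ <ₒ θ → ¬ A θ′ x) × OppositeParity θ η)

InDΣ¹₁ : Ordinal → (X : Space) → Pred (Point X) 0ℓ → Set₁
InDΣ¹₁ η X E =
  Σ[ A ∈ (Ordinal → Pred (Point X) 0ℓ) ]
    ((∀ θ → θ <ₒ η → Analytic X (A θ)) × Increasing η A × E ≐ D η A)

DΣ¹₁-Complete : Ordinal → (X : Space) → Pred (Point X) 0ℓ → Set₁
DΣ¹₁-Complete η X F =
  ∀ k (E : Pred (Point (Words (Fin k))) 0ℓ) →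
  InDΣ¹₁ η (Words (Fin k)) E ⇔ WadgeReducible (Words (Fin k)) X E F

------------------------------------------------------------------------
-- Trees

data Direction : Set where
  l r : Direction

Node : Set
Node = List Direction

Tree : Set → Set
Tree A = Node → A

Trees : Set → Space
Trees A = Product Node A

subtree : {A : Set} → Tree A → Node → Tree A
subtree t u v = t (u ++ v)

record Branch : Set where
  field
    node  : ℕ → Node
    start : node 0 ≡ []
    step  : ∀ i → node (suc i) ≡ node i ∷ʳ l ⊎ node (suc i) ≡ node i ∷ʳ r

path : {A : Set} → Tree A → Branch → ℕ → A
path t b i = t (Branch.node b i)

InfinitelyOften : {A : Set} → A → (ℕ → A) → Set
InfinitelyOften a w = ∀ n → ∃[ m ] (n ℕ.≤ m × w m ≡ a)

------------------------------------------------------------------------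
-- Muller tree automata

record MullerAutomaton (s : ℕ) : Set where
  field
    states : ℕ
    Δ      : Fin states → Fin s → Fin states → Fin states → Bool
    q₀     : Fin states
    𝓕      : Subset states → Bool

  IsRun : Tree (Fin s) → Tree (Fin states) → Set
  IsRun t ρ =
    ρ [] ≡ q₀ × (∀ u → T (Δ (ρ u) (t u) (ρ (u ∷ʳ l)) (ρ (u ∷ʳ r))))

  IsAccepting : Tree (Fin states) → Set
  IsAccepting ρ =
    ∀ b → ∃[ S ] ((∀ q → q ∈ S ⇔ InfinitelyOften q (path ρ b)) × T (𝓕 S))

  Accepts : Pred (Tree (Fin s)) 0ℓ
  Accepts t = ∃[ ρ ] (IsRun t ρ × IsAccepting ρ)

MullerRecognizable : (s : ℕ) → Pred (Tree (Fin s)) 0ℓ → Set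
MullerRecognizable s L =
  Σ[ 𝓐 ∈ MullerAutomaton s ] (L ≐ MullerAutomaton.Accepts 𝓐)

------------------------------------------------------------------------
-- The languages 𝓛 and 𝓛ₙ, over the alphabet {0,1} = Fin 2

𝓛 : Pred (Tree (Fin 2)) 0ℓ
𝓛 t = ∃[ b ] InfinitelyOften (suc zero) (path t b)

-- Coefficient vectors a_{n-1} ∷ … ∷ a₀ ∷ [] list the leading coefficient
-- first.

Ord : ∀ {n} → Vec ℕ (suc n) → Ordinal
Ord             (a ∷ [])         = fromℕ a
Ord {n = suc n} (a ∷ as@(_ ∷ _)) = (ω^ (suc n)) ·ₒ fromℕ a +ₒ Ord as

address : ∀ {n} → Vec ℕ n → Node
address []       = []
address (a ∷ as) = replicate a l ++ r ∷ address as

𝓛ₙ : (n : ℕ) .{{_ : NonZero n}} → Pred (Tree (Fin 2)) 0ℓ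
𝓛ₙ 1 t =
  ∃[ m ] ( 𝓛 (subtree t (replicate m l ∷ʳ r))
         × (∀ m′ → m′ ℕ.< m → ¬ 𝓛 (subtree t (replicate m′ l ∷ʳ r)))
         × ¬ 2 ∣ m)
𝓛ₙ n@(suc (suc _)) t =
  Σ[ a ∈ Vec ℕ n ]
    ( (𝓛 (subtree t (address a)) × Odd (Ord a))
    × (∀ (b : Vec ℕ n) → Ord b <ₒ Ord a → ¬ 𝓛 (subtree t (address b))))

{-# OPTIONS --safe #-}

-- Every ordinal below ωⁿ is Ord a for some a ∈ ℕⁿ, and its parity is that of
-- the last coefficient. A continuous preimage of 𝓛ₙ is therefore D_{ωⁿ} of the
-- sets "the subtree below some address a with Ord a ≤ θ is in 𝓛", which are
-- projections of closed sets. Conversely, 𝓛 is Σ¹₁-hard: if A is the projection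
-- of a closed C, write y ∈ ℕ^ℕ as a branch and put a 1 at those nodes that end a
-- block and agree, together with x, with some point of C. By closedness of C the
-- tree so obtained is in 𝓛 iff x ∈ A. Grafting these trees for the sets A_{Ord a}
-- below the addresses a reduces D_{ωⁿ}[(A_θ)] to 𝓛ₙ.
-- An automaton for 𝓛ₙ guesses the least a and a branch below it with infinitely
-- many 1s; every subtree at a lexicographically smaller address hangs to the
-- right of the guessed path and is checked to be outside 𝓛, which is a condition
-- on all of its branches.

module Submission where

open import Defs
open Space using (Point)
open import Level using (0ℓ)
open import Axiom.ExcludedMiddle using (ExcludedMiddle)
open import Axiom.DoubleNegationElimination using (em⇒dne)
open import Data.Bool.Base using (Bool; true; false; not; T)
open import Data.Empty using (⊥-elim)
open import Data.Bool.Properties using (T-≡)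
open import Data.Fin.Base using (Fin; zero; suc; toℕ; inject₁) renaming (fromℕ to fromℕF)
open import Data.Fin.Patterns using (0F; 1F)
open import Data.Fin.Properties using (toℕ-inject₁; toℕ-fromℕ; +↔⊎; *↔×; 1↔⊤; 2↔Bool)
open import Data.Fin.Subset using (Subset; _∈_)
open import Data.Nat.Base as ℕ using (ℕ; zero; suc; NonZero; z≤n; s≤s)
import Data.Nat.Properties as ℕₚ
open import Data.Nat.Divisibility using (_∣_; ∣m+n∣m⇒∣n; ∣m∣n⇒∣m+n; ∣-refl; _∣0; >⇒∤)
open import Data.List.Base using (List; []; _∷_; _++_; _∷ʳ_; length)
open import Data.List.Properties using (∷ʳ-injectiveʳ)
open import Data.List.Relation.Unary.All using ([]; _∷_)
open import Data.Product.Base using (Σ-syntax; ∃-syntax; _×_; _,_; proj₁; proj₂)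
open import Data.Product.Function.NonDependent.Propositional using (_×-↔_)
open import Data.Sum.Base using (_⊎_; inj₁; inj₂; [_,_]′; map₁)
open import Data.Sum.Function.Propositional using (_⊎-↔_)
open import Data.Unit.Base using (⊤; tt)
open import Data.Vec.Base using (Vec; []; _∷_; tabulate)
open import Data.Vec.Properties using (lookup∘tabulate; []=⇒lookup; lookup⇒[]=)
open import Function.Base using (_∘_)
open import Function.Bundles using (_⇔_; _↔_; mk⇔; Equivalence; Inverse)
open import Function.Construct.Composition using (_↔-∘_; _⇔-∘_)
open import Function.Construct.Identity using (↔-id)
open import Function.Construct.Symmetry using (⇔-sym)
open import Relation.Binary.Definitions using (tri<; tri≈; tri>)
open import Relation.Binary.PropositionalEquality
  using (_≡_; refl; sym; trans; cong; cong₂; subst)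
open import Relation.Nullary.Negation using (¬_; contradiction)
open import Relation.Nullary.Decidable.Core using (yes; no; isYes; toWitness; fromWitness)
open import Relation.Unary using (Pred; _≐_; _⊢_)
open import Relation.Unary.Properties using (≐-trans)

-- Ordinals

≤ₒ-refl : ∀ {α} → α ≤ₒ α
≤ₒ-refl {zero}  = zero≤
≤ₒ-refl {suc α} = suc≤suc ≤ₒ-refl
≤ₒ-refl {lim f} = lim≤ λ n → ≤lim n ≤ₒ-refl

≤ₒ-reflexive : ∀ {α β} → α ≡ β → α ≤ₒ β
≤ₒ-reflexive refl = ≤ₒ-refl

≤ₒ-trans : ∀ {α β γ} → α ≤ₒ β → β ≤ₒ γ → α ≤ₒ γ
≤ₒ-trans zero≤       q           = zero≤
≤ₒ-trans (lim≤ h)    q           = lim≤ λ n → ≤ₒ-trans (h n) q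
≤ₒ-trans (suc≤suc p) (suc≤suc q) = suc≤suc (≤ₒ-trans p q)
≤ₒ-trans (suc≤suc p) (≤lim n q)  = ≤lim n (≤ₒ-trans (suc≤suc p) q)
≤ₒ-trans (≤lim n p)  (lim≤ h)    = ≤ₒ-trans p (h n)
≤ₒ-trans (≤lim n p)  (≤lim m q)  = ≤lim m (≤ₒ-trans (≤lim n p) q)

α≤sucα : ∀ {α} → α ≤ₒ suc α
α≤sucα {zero}  = zero≤
α≤sucα {suc α} = suc≤suc α≤sucα
α≤sucα {lim f} = lim≤ λ n → ≤ₒ-trans α≤sucα (suc≤suc (≤lim n ≤ₒ-refl))

<ₒ⇒≤ₒ : ∀ {α β} → α <ₒ β → α ≤ₒ β
<ₒ⇒≤ₒ = ≤ₒ-trans α≤sucα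

≤-<ₒ-trans : ∀ {α β γ} → α ≤ₒ β → β <ₒ γ → α <ₒ γ
≤-<ₒ-trans p = ≤ₒ-trans (suc≤suc p)

suc≤suc⁻¹ : ∀ {α β} → suc α ≤ₒ suc β → α ≤ₒ β
suc≤suc⁻¹ (suc≤suc p) = p

<ₒ-irrefl : ∀ {α} → ¬ α <ₒ α
<ₒ-irrefl {suc α} (suc≤suc p) = <ₒ-irrefl p
<ₒ-irrefl {lim f} (≤lim n p)  = <ₒ-irrefl (≤-<ₒ-trans (≤lim n ≤ₒ-refl) p)

≈ₒ-refl : ∀ {α} → α ≈ₒ α
≈ₒ-refl = ≤ₒ-refl , ≤ₒ-refl

≈ₒ-sym : ∀ {α β} → α ≈ₒ β → β ≈ₒ α
≈ₒ-sym (p , q) = q , p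

≈ₒ-trans : ∀ {α β γ} → α ≈ₒ β → β ≈ₒ γ → α ≈ₒ γ
≈ₒ-trans (p , q) (p′ , q′) = ≤ₒ-trans p p′ , ≤ₒ-trans q′ q

α≤α+β : ∀ α β → α ≤ₒ α +ₒ β
α≤α+β α zero    = ≤ₒ-refl
α≤α+β α (suc β) = ≤ₒ-trans (α≤α+β α β) α≤sucα
α≤α+β α (lim f) = ≤lim 0 (α≤α+β α (f 0))

+ₒ-monoʳ-≤ : ∀ α {β γ} → β ≤ₒ γ → α +ₒ β ≤ₒ α +ₒ γ
+ₒ-monoʳ-≤ α (zero≤ {γ}) = α≤α+β α γ
+ₒ-monoʳ-≤ α (suc≤suc p) = suc≤suc (+ₒ-monoʳ-≤ α p)
+ₒ-monoʳ-≤ α (≤lim n p)  = ≤lim n (+ₒ-monoʳ-≤ α p)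
+ₒ-monoʳ-≤ α (lim≤ h)    = lim≤ λ n → +ₒ-monoʳ-≤ α (h n)

+ₒ-congʳ : ∀ α {β γ} → β ≈ₒ γ → α +ₒ β ≈ₒ α +ₒ γ
+ₒ-congʳ α (p , q) = +ₒ-monoʳ-≤ α p , +ₒ-monoʳ-≤ α q

+ₒ-identityˡ-fromℕ : ∀ n → zero +ₒ fromℕ n ≡ fromℕ n
+ₒ-identityˡ-fromℕ zero    = refl
+ₒ-identityˡ-fromℕ (suc n) = cong suc (+ₒ-identityˡ-fromℕ n)

+ₒ-assoc-fromℕ : ∀ α β n → α +ₒ (β +ₒ fromℕ n) ≡ (α +ₒ β) +ₒ fromℕ n
+ₒ-assoc-fromℕ α β zero    = refl
+ₒ-assoc-fromℕ α β (suc n) = cong suc (+ₒ-assoc-fromℕ α β n)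

fromℕ-mono-≤ : ∀ {m n} → m ℕ.≤ n → fromℕ m ≤ₒ fromℕ n
fromℕ-mono-≤ z≤n     = zero≤
fromℕ-mono-≤ (s≤s p) = suc≤suc (fromℕ-mono-≤ p)

fromℕ-cancel-≤ : ∀ {m n} → fromℕ m ≤ₒ fromℕ n → m ℕ.≤ n
fromℕ-cancel-≤ {zero}          p           = z≤n
fromℕ-cancel-≤ {suc m} {suc n} (suc≤suc p) = s≤s (fromℕ-cancel-≤ p)

·ₒ-monoʳ-fromℕ : ∀ α {m n} → m ℕ.≤ n → α ·ₒ fromℕ m ≤ₒ α ·ₒ fromℕ n
·ₒ-monoʳ-fromℕ α p = go (ℕₚ.≤⇒≤′ p)
  where
  go : ∀ {m n} → m ℕ.≤′ n → α ·ₒ fromℕ m ≤ₒ α ·ₒ fromℕ n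
  go ℕ.≤′-refl     = ≤ₒ-refl
  go (ℕ.≤′-step p) = ≤ₒ-trans (go p) (α≤α+β _ α)

1·ₒfromℕ : ∀ n → fromℕ 1 ·ₒ fromℕ n ≡ fromℕ n
1·ₒfromℕ zero    = refl
1·ₒfromℕ (suc n) = cong suc (1·ₒfromℕ n)

0<ω^ : ∀ n → zero <ₒ ω^ n
0<ω^ zero    = ≤ₒ-refl
0<ω^ (suc n) = ≤lim 1 (≤ₒ-trans (0<ω^ n) (0+α≥α (ω^ n)))
  where
  0+α≥α : ∀ α → α ≤ₒ zero +ₒ α
  0+α≥α zero    = zero≤
  0+α≥α (suc α) = suc≤suc (0+α≥α α)
  0+α≥α (lim f) = lim≤ λ n → ≤lim n (0+α≥α (f n))

-- The lower terms add up to less than one more copy of the leading power, so the sum stays below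
-- the multiple with coefficient a + 1.
Ord<ω^ : ∀ {k} (a : Vec ℕ (suc k)) → Ord a <ₒ ω^ (suc k)
Ord<ω^ (a ∷ [])         = ≤lim (suc a) (suc≤suc (≤ₒ-reflexive (sym (1·ₒfromℕ a))))
Ord<ω^ (a ∷ as@(_ ∷ _)) = ≤lim (suc a) (+ₒ-monoʳ-≤ _ (Ord<ω^ as))

-- The lexicographic order on coefficient vectors

infix 4 _<ₗ_

data _<ₗ_ : ∀ {n} → Vec ℕ n → Vec ℕ n → Set where
  here  : ∀ {n m m′} {as bs : Vec ℕ n} → m ℕ.< m′ → (m ∷ as) <ₗ (m′ ∷ bs)
  there : ∀ {n m} {as bs : Vec ℕ n} → as <ₗ bs → (m ∷ as) <ₗ (m ∷ bs)

<ₗ-cmp : ∀ {n} (a b : Vec ℕ n) → a <ₗ b ⊎ a ≡ b ⊎ b <ₗ a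
<ₗ-cmp []       []       = inj₂ (inj₁ refl)
<ₗ-cmp (x ∷ as) (y ∷ bs) with ℕₚ.<-cmp x y
... | tri< p _ _ = inj₁ (here p)
... | tri> _ _ p = inj₂ (inj₂ (here p))
... | tri≈ _ refl _ with <ₗ-cmp as bs
...   | inj₁ p           = inj₁ (there p)
...   | inj₂ (inj₁ refl) = inj₂ (inj₁ refl)
...   | inj₂ (inj₂ p)    = inj₂ (inj₂ (there p))

-- At the first difference, one further copy of that power of ω outweighs all lower terms, by
-- `Ord<ω^`.
Ord-mono-< : ∀ {k} {a b : Vec ℕ (suc k)} → a <ₗ b → Ord a <ₒ Ord b
Ord-mono-< {a = _ ∷ []}     {_ ∷ []}      (here p)  = fromℕ-mono-≤ p
Ord-mono-< {a = _ ∷ as@(_ ∷ _)} {_ ∷ _ ∷ _} (here p)  =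
  ≤ₒ-trans (+ₒ-monoʳ-≤ _ (Ord<ω^ as)) (≤ₒ-trans (·ₒ-monoʳ-fromℕ _ p) (α≤α+β _ _))
Ord-mono-< {a = _ ∷ _ ∷ _}  {_ ∷ _ ∷ _}   (there p) = +ₒ-monoʳ-≤ _ (Ord-mono-< p)

Ord-cancel-< : ∀ {k} {a b : Vec ℕ (suc k)} → Ord a <ₒ Ord b → a <ₗ b
Ord-cancel-< {a = a} {b} p with <ₗ-cmp a b
... | inj₁ q           = q
... | inj₂ (inj₁ refl) = contradiction p <ₒ-irrefl
... | inj₂ (inj₂ q)    =
  contradiction (≤-<ₒ-trans (<ₒ⇒≤ₒ p) (Ord-mono-< q)) <ₒ-irrefl

last : ∀ {k} → Vec ℕ (suc k) → ℕ
last (m ∷ [])         = m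
last (m ∷ as@(_ ∷ _)) = last as

-- Limit ordinals and parity

ZeroOrLimit : Ordinal → Set
ZeroOrLimit γ = γ ≈ₒ zero ⊎ IsLimit γ

IsLimit-resp-≈ₒ : ∀ {α β} → α ≈ₒ β → IsLimit α → IsLimit β
IsLimit-resp-≈ₒ (α≤β , β≤α) (0<α , suc<) =
  ≤ₒ-trans 0<α α≤β ,
  λ γ γ<β → ≤ₒ-trans (suc< γ (≤ₒ-trans γ<β β≤α)) α≤β

-- An ordinal below the m-th multiple of ω^n has its successor below the next multiple, since ω^n is
-- positive.
IsLimit-ω^ : ∀ n → IsLimit (ω^ (suc n))
IsLimit-ω^ n = 0<ω^ (suc n) , λ { β (≤lim m p) →
  ≤lim (suc m) (≤ₒ-trans (suc≤suc p) (+ₒ-monoʳ-≤ _ (0<ω^ n))) }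

IsLimit-+fromℕ : ∀ {γ} → IsLimit γ → ∀ {α} n → α <ₒ γ → α +ₒ fromℕ n <ₒ γ
IsLimit-+fromℕ isLim         zero    p = p
IsLimit-+fromℕ isLim@(_ , h) (suc n) p = h _ (IsLimit-+fromℕ isLim n p)

ZeroOrLimit-< : ∀ {γ} → ZeroOrLimit γ → ∀ {α} n → α <ₒ γ → α +ₒ fromℕ n <ₒ γ
ZeroOrLimit-< (inj₂ isLim)     n p = IsLimit-+fromℕ isLim n p
ZeroOrLimit-< (inj₁ (γ≤0 , _)) n p with () ← ≤ₒ-trans p γ≤0

-- Cancelling common successors would leave some γ ≈ γ′ + (m′ + 1); but a zero or limit ordinal
-- above γ′ is also above γ′ plus any finite ordinal.
finitePart-unique : ∀ {γ γ′} → ZeroOrLimit γ → ZeroOrLimit γ′ → ∀ m m′ →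
                    γ +ₒ fromℕ m ≈ₒ γ′ +ₒ fromℕ m′ → m ≡ m′
finitePart-unique z z′ zero    zero     _       = refl
finitePart-unique z z′ (suc m) (suc m′) (p , q) =
  cong suc (finitePart-unique z z′ m m′ (suc≤suc⁻¹ p , suc≤suc⁻¹ q))
finitePart-unique z z′ zero (suc m′) (p , q) =
  contradiction (≤ₒ-trans (ZeroOrLimit-< z (suc m′) (≤-<ₒ-trans (α≤α+β _ _) q)) p) <ₒ-irrefl
finitePart-unique z z′ (suc m) zero (p , q) =
  contradiction (≤ₒ-trans (ZeroOrLimit-< z′ (suc m) (≤-<ₒ-trans (α≤α+β _ _) p)) q) <ₒ-irrefl

Even-resp-≈ₒ : ∀ {α β} → α ≈ₒ β → Even α → Even β
Even-resp-≈ₒ e (γ , m , z , 2∣m , e′) = γ , m , z , 2∣m , ≈ₒ-trans (≈ₒ-sym e) e′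

Odd-resp-≈ₒ : ∀ {α β} → α ≈ₒ β → Odd α → Odd β
Odd-resp-≈ₒ e odd even = odd (Even-resp-≈ₒ (≈ₒ-sym e) even)

Even-ω^ : ∀ n → Even (ω^ (suc n))
Even-ω^ n = ω^ (suc n) , 0 , inj₂ (IsLimit-ω^ n) , (2 ∣0) , ≈ₒ-refl

-- Comparison, Cantor normal form and parity, using excluded middle

module Classical (em : ExcludedMiddle 0ℓ) where

  dne : ∀ {P : Set} → ¬ ¬ P → P
  dne = em⇒dne em

  ¬∀⇒∃¬ : {A : Set} {P : A → Set} → ¬ (∀ x → P x) → ∃[ x ] ¬ P x
  ¬∀⇒∃¬ h = dne λ ne → h λ x → dne λ np → ne (x , np)

  -- At a limit, excluded middle decides whether some member already reaches the other ordinal; if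
  -- none does, every member is bounded and so is the supremum.
  ≤ₒ-or->ₒ : ∀ α β → α ≤ₒ β ⊎ β <ₒ α
  ≤ₒ-or->ₒ zero    β       = inj₁ zero≤
  ≤ₒ-or->ₒ (suc α) zero    = inj₂ (suc≤suc zero≤)
  ≤ₒ-or->ₒ (suc α) (suc β) with ≤ₒ-or->ₒ α β
  ... | inj₁ p = inj₁ (suc≤suc p)
  ... | inj₂ p = inj₂ (suc≤suc p)
  ≤ₒ-or->ₒ (suc α) (lim g) with em {∃[ n ] suc α ≤ₒ g n}
  ... | yes (n , p) = inj₁ (≤lim n p)
  ... | no np       = inj₂ (suc≤suc (lim≤ λ n →
    [ (λ p → contradiction (n , p) np) , suc≤suc⁻¹ ]′ (≤ₒ-or->ₒ (suc α) (g n))))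
  ≤ₒ-or->ₒ (lim f) β with em {∃[ n ] β <ₒ f n}
  ... | yes (n , p) = inj₂ (≤lim n p)
  ... | no np       = inj₁ (lim≤ λ n →
    [ (λ p → p) , (λ p → contradiction (n , p) np) ]′ (≤ₒ-or->ₒ (f n) β))

  subtract : ∀ α β {θ} → α ≤ₒ θ → θ <ₒ α +ₒ β → ∃[ δ ] (δ <ₒ β × θ ≈ₒ α +ₒ δ)
  subtract α zero    p q = contradiction (≤-<ₒ-trans p q) <ₒ-irrefl
  subtract α (suc β) {θ} p (suc≤suc q) with ≤ₒ-or->ₒ (α +ₒ β) θ
  ... | inj₁ q′ = β , ≤ₒ-refl , q , q′
  ... | inj₂ q′ with δ , δ<β , e ← subtract α β p q′ = δ , ≤ₒ-trans δ<β α≤sucα , e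
  subtract α (lim f) p (≤lim n q) with δ , δ<β , e ← subtract α (f n) p q =
    δ , ≤lim n δ<β , e

  -- Division with remainder: θ lies either in the last copy of α, where `subtract` yields the
  -- remainder, or below that copy.
  divide : ∀ α m {θ} → θ <ₒ α ·ₒ fromℕ m →
           ∃[ j ] ∃[ δ ] (δ <ₒ α × θ ≈ₒ α ·ₒ fromℕ j +ₒ δ)
  divide α (suc m) {θ} p with ≤ₒ-or->ₒ (α ·ₒ fromℕ m) θ
  ... | inj₁ q = m , subtract (α ·ₒ fromℕ m) α q p
  ... | inj₂ q = divide α m q

  -- Cantor normal form by repeated division. The limit that defines ω^(k+1) provides a finite
  -- multiple of ω^k above θ, so `divide` applies at each stage.
  Ord-surjective : ∀ k {θ} → θ <ₒ ω^ (suc k) → ∃[ a ] θ ≈ₒ Ord {k} a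
  Ord-surjective zero (≤lim m p) with divide (fromℕ 1) m p
  ... | j , δ , suc≤suc δ≤0 , e =
    j ∷ [] , ≈ₒ-trans e (≈ₒ-trans (+ₒ-congʳ _ (δ≤0 , zero≤))
               (subst (_≈ₒ fromℕ j) (sym (1·ₒfromℕ j)) ≈ₒ-refl))
  Ord-surjective (suc k) (≤lim m p) with divide (ω^ (suc k)) m p
  ... | j , δ , δ< , e with Ord-surjective k δ<
  ...   | as@(_ ∷ _) , e′ = j ∷ as , ≈ₒ-trans e (+ₒ-congʳ _ e′)

  -- An ordinal below α + γ is either below α or of the form α + δ with δ below γ.
  IsLimit-+ₒ : ∀ α {γ} → IsLimit γ → IsLimit (α +ₒ γ)
  IsLimit-+ₒ α {γ} (0<γ , suc<) = 0<α+γ , step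
    where
    α<α+γ : α <ₒ α +ₒ γ
    α<α+γ = +ₒ-monoʳ-≤ α 0<γ
    0<α+γ : zero <ₒ α +ₒ γ
    0<α+γ = ≤-<ₒ-trans zero≤ α<α+γ
    step : ∀ β → β <ₒ α +ₒ γ → suc β <ₒ α +ₒ γ
    step β p with ≤ₒ-or->ₒ α β
    ... | inj₂ q = ≤-<ₒ-trans q α<α+γ
    ... | inj₁ q with δ , δ<γ , (β≤ , _) ← subtract α γ q p =
      ≤-<ₒ-trans (suc≤suc β≤) (+ₒ-monoʳ-≤ α (suc< δ δ<γ))

  ZeroOrLimit-+ₒ : ∀ {α γ} → ZeroOrLimit α → ZeroOrLimit γ → ZeroOrLimit (α +ₒ γ)
  ZeroOrLimit-+ₒ {α} z        (inj₂ isLim) = inj₂ (IsLimit-+ₒ α isLim)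
  ZeroOrLimit-+ₒ {α} (inj₁ z) (inj₁ e)   = inj₁ (≈ₒ-trans (+ₒ-congʳ α e) z)
  ZeroOrLimit-+ₒ {α} (inj₂ h) (inj₁ e)   =
    inj₂ (IsLimit-resp-≈ₒ (≈ₒ-sym (+ₒ-congʳ α e)) h)

  ZeroOrLimit-·ₒ : ∀ {α} → IsLimit α → ∀ m → ZeroOrLimit (α ·ₒ fromℕ m)
  ZeroOrLimit-·ₒ isLim zero    = inj₁ ≈ₒ-refl
  ZeroOrLimit-·ₒ isLim (suc m) = inj₂ (IsLimit-+ₒ _ isLim)

  Ord-finitePart : ∀ {k} (a : Vec ℕ (suc k)) →
                   ∃[ γ ] (ZeroOrLimit γ × Ord a ≡ γ +ₒ fromℕ (last a))
  Ord-finitePart (m ∷ [])         = zero , inj₁ ≈ₒ-refl , sym (+ₒ-identityˡ-fromℕ m)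
  Ord-finitePart {suc k} (m ∷ as@(_ ∷ _)) with γ , z , e ← Ord-finitePart as =
    _ , ZeroOrLimit-+ₒ (ZeroOrLimit-·ₒ (IsLimit-ω^ k) m) z ,
    trans (cong (ω^ (suc k) ·ₒ fromℕ m +ₒ_) e) (+ₒ-assoc-fromℕ _ γ (last as))

  Odd-Ord⇒2∤last : ∀ {k} (a : Vec ℕ (suc k)) → Odd (Ord a) → ¬ 2 ∣ last a
  Odd-Ord⇒2∤last a odd 2∣m with γ , z , e ← Ord-finitePart a =
    odd (γ , last a , z , 2∣m , subst (Ord a ≈ₒ_) e ≈ₒ-refl)

  -- `Odd` says that no even decomposition exists; uniqueness of the finite part excludes all of
  -- them at once.
  2∤last⇒Odd-Ord : ∀ {k} (a : Vec ℕ (suc k)) → ¬ 2 ∣ last a → Odd (Ord a)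
  2∤last⇒Odd-Ord a 2∤m (γ′ , m′ , z′ , 2∣m′ , e′) with γ , z , e ← Ord-finitePart a =
    2∤m (subst (2 ∣_) (finitePart-unique z′ z m′ (last a)
      (≈ₒ-sym (subst (_≈ₒ γ′ +ₒ fromℕ m′) e e′))) 2∣m′)

-- Branches and cylinders

Inf : {A : Set} → A → (ℕ → A) → Set
Inf = InfinitelyOften

-- Branches are handled as sequences of directions: their prefixes grow from the front, which suits
-- descent into subtrees.
prefix : (ℕ → Direction) → ℕ → Node
prefix d zero    = []
prefix d (suc n) = d 0 ∷ prefix (d ∘ suc) n

prefix-∷ʳ : ∀ d n → prefix d (suc n) ≡ prefix d n ∷ʳ d n
prefix-∷ʳ d zero    = refl
prefix-∷ʳ d (suc n) = cong (d 0 ∷_) (prefix-∷ʳ (d ∘ suc) n)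

length-prefix : ∀ d n → length (prefix d n) ≡ n
length-prefix d zero    = refl
length-prefix d (suc n) = cong suc (length-prefix (d ∘ suc) n)

prefix-cong : ∀ {d d′} n → (∀ i → i ℕ.< n → d i ≡ d′ i) → prefix d n ≡ prefix d′ n
prefix-cong zero    h = refl
prefix-cong (suc n) h =
  cong₂ _∷_ (h 0 (s≤s z≤n)) (prefix-cong n (λ i i<n → h (suc i) (s≤s i<n)))

toBranch : (ℕ → Direction) → Branch
toBranch d = record { node = prefix d ; start = refl ; step = step }
  where
  step : ∀ i → prefix d (suc i) ≡ prefix d i ∷ʳ l ⊎ prefix d (suc i) ≡ prefix d i ∷ʳ r
  step i with d i | prefix-∷ʳ d i
  ... | l | e = inj₁ e
  ... | r | e = inj₂ e

fromBranch : (b : Branch) → ∃[ d ] (∀ i → Branch.node b i ≡ prefix d i)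
fromBranch b = d , node≡
  where
  open Branch b
  next : ∀ i → ∃[ e ] node (suc i) ≡ node i ∷ʳ e
  next i = [ l ,_ , r ,_ ]′ (step i)
  d : ℕ → Direction
  d i = proj₁ (next i)
  node≡ : ∀ i → node i ≡ prefix d i
  node≡ zero    = start
  node≡ (suc i) =
    trans (proj₂ (next i)) (trans (cong (_∷ʳ d i) (node≡ i)) (sym (prefix-∷ʳ d i)))

Inf-cong : {A : Set} {a : A} {w w′ : ℕ → A} → (∀ i → w i ≡ w′ i) → Inf a w → Inf a w′
Inf-cong e inf n with m , n≤m , p ← inf n = m , n≤m , trans (sym (e m)) p

Inf-tail : {A : Set} {a : A} {w : ℕ → A} → Inf a w → Inf a (w ∘ suc)
Inf-tail inf n with suc m , s≤s n≤m , p ← inf (suc n) = m , n≤m , p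

Inf-untail : {A : Set} {a : A} {w : ℕ → A} → Inf a (w ∘ suc) → Inf a w
Inf-untail inf n with m , n≤m , p ← inf n = suc m , ℕₚ.m≤n⇒m≤1+n n≤m , p

𝓛⇒directions : ∀ {t} → 𝓛 t → ∃[ d ] Inf 1F (t ∘ prefix d)
𝓛⇒directions {t} (b , inf) with d , e ← fromBranch b = d , Inf-cong (cong t ∘ e) inf

directions⇒𝓛 : ∀ {t} d → Inf 1F (t ∘ prefix d) → 𝓛 t
directions⇒𝓛 d inf = toBranch d , inf

𝓛-cong : ∀ {t t′} → (∀ u → t u ≡ t′ u) → 𝓛 t → 𝓛 t′
𝓛-cong e (b , inf) = b , Inf-cong (λ i → e _) inf

-- Cylinders, and continuity of maps from words to trees

Agree : {A : Set} → ℕ → (ℕ → A) → (ℕ → A) → Set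
Agree N x y = ∀ i → i ℕ.< N → x i ≡ y i

Agree-≤ : {A : Set} {x y : ℕ → A} {M N : ℕ} → M ℕ.≤ N → Agree N x y → Agree M x y
Agree-≤ M≤N h i i<M = h i (ℕₚ.<-≤-trans i<M M≤N)

cylinder : {A : Set} → (ℕ → A) → ℕ → List (ℕ × A)
cylinder x zero    = []
cylinder x (suc N) = (N , x N) ∷ cylinder x N

∈-cylinder : {A : Set} (x : ℕ → A) (N : ℕ) → Space._∈ᵇ_ (Words A) x (cylinder x N)
∈-cylinder x zero    = []
∈-cylinder x (suc N) = refl ∷ ∈-cylinder x N

∈-cylinder⇒Agree : {A : Set} {x y : ℕ → A} (N : ℕ) →
                   Space._∈ᵇ_ (Words A) y (cylinder x N) → Agree N x y
∈-cylinder⇒Agree (suc N) (e ∷ es) i (s≤s i≤N) with ℕₚ.m≤n⇒m<n∨m≡n i≤N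
... | inj₁ i<N  = ∈-cylinder⇒Agree N es i i<N
... | inj₂ refl = sym e

Agree⇒∈ : {A : Set} {x : ℕ → A} (b : List (ℕ × A)) → Space._∈ᵇ_ (Words A) x b →
          ∃[ N ] (∀ y → Agree N x y → Space._∈ᵇ_ (Words A) y b)
Agree⇒∈ []            []       = 0 , λ y _ → []
Agree⇒∈ ((i , a) ∷ b) (e ∷ es) with N , h ← Agree⇒∈ b es =
  suc i ℕ.⊔ N , λ y agree →
    trans (sym (Agree-≤ (ℕₚ.m≤m⊔n (suc i) N) agree i ℕₚ.≤-refl)) e ∷
    h y (Agree-≤ (ℕₚ.m≤n⊔m (suc i) N) agree)

-- A Lipschitz form of continuity: a label at depth n depends on the first n letters only.
Local : {A B : Set} → ((ℕ → A) → Tree B) → Set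
Local f = ∀ u x y → Agree (length u) x y → f x u ≡ f y u

Local⇒modulus : {A B : Set} {f : (ℕ → A) → Tree B} → Local f → ∀ x (b : List (Node × B)) →
                Space._∈ᵇ_ (Trees B) (f x) b →
                ∃[ N ] (∀ y → Agree N x y → Space._∈ᵇ_ (Trees B) (f y) b)
Local⇒modulus loc x []            []       = 0 , λ y _ → []
Local⇒modulus loc x ((u , a) ∷ b) (e ∷ es) with N , h ← Local⇒modulus loc x b es =
  length u ℕ.⊔ N , λ y agree →
    trans (sym (loc u x y (Agree-≤ (ℕₚ.m≤m⊔n (length u) N) agree))) e ∷
    h y (Agree-≤ (ℕₚ.m≤n⊔m (length u) N) agree)

Local⇒Continuous : {A B : Set} {f : (ℕ → A) → Tree B} → Local f →
                   Continuous (Words A) (Trees B) f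
Local⇒Continuous {f = f} loc U open-U x fx∈U with b , fx∈b , b⊆U ← open-U (f x) fx∈U
  with N , h ← Local⇒modulus loc x b fx∈b =
  cylinder x N , ∈-cylinder x N , λ y y∈ → b⊆U (f y) (h y (∈-cylinder⇒Agree N y∈))

-- Σ¹₁-hardness of 𝓛

-- The members of graft n c g below the nodes `address a`, for a ∈ ℕⁿ, are the
-- trees g a; all nodes that lie below no address get the label c.
graft : {A : Set} (n : ℕ) → A → (Vec ℕ n → Tree A) → Tree A
graft zero    c g u       = g [] u
graft (suc n) c g []      = c
graft (suc n) c g (l ∷ u) = graft (suc n) c (λ { (m ∷ as) → g (suc m ∷ as) }) u
graft (suc n) c g (r ∷ u) = graft n c (λ as → g (0 ∷ as)) u

subtree-graft : {A : Set} (n : ℕ) (c : A) (g : Vec ℕ n → Tree A) (a : Vec ℕ n) →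
                ∀ v → subtree (graft n c g) (address a) v ≡ g a v
subtree-graft zero    c g []           v = refl
subtree-graft (suc n) c g (zero ∷ as)  v = subtree-graft n c _ as v
subtree-graft (suc n) c g (suc m ∷ as) v = subtree-graft (suc n) c _ (m ∷ as) v

-- Grafting only moves trees downwards, so a label at u comes from a node no longer than u. This
-- carries `Local` over from the grafted trees to the whole.
graft-cong : {A : Set} (n : ℕ) (c : A) {g g′ : Vec ℕ n → Tree A} (u : Node) →
             (∀ a v → length v ℕ.≤ length u → g a v ≡ g′ a v) →
             graft n c g u ≡ graft n c g′ u
graft-cong zero    c u       h = h [] u ℕₚ.≤-refl
graft-cong (suc n) c []      h = refl
graft-cong (suc n) c (l ∷ u) h =
  graft-cong (suc n) c u (λ { (m ∷ as) v p → h (suc m ∷ as) v (ℕₚ.m≤n⇒m≤1+n p) })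
graft-cong (suc n) c (r ∷ u) h =
  graft-cong n c u (λ as v p → h (0 ∷ as) v (ℕₚ.m≤n⇒m≤1+n p))

-- An element of Baire space is written on a branch in unary: y 0 times l, then
-- r, then y 1 times l, then r, and so on. `Codes c y u` says that lᶜ u is an
-- initial segment of that branch up to a longer last block of l's.
Codes : ℕ → (ℕ → ℕ) → Node → Set
Codes c y []      = ⊤
Codes c y (l ∷ u) = Codes (suc c) y u
Codes c y (r ∷ u) = y 0 ≡ c × Codes 0 (y ∘ suc) u

-- `c` counts the letters l still to be written in the current block and `y` lists the later blocks;
-- the branch of a point y is thus `code (y 0) (y ∘ suc)`.
code : ℕ → (ℕ → ℕ) → ℕ → Direction
code zero    y zero    = r
code zero    y (suc i) = code (y 0) (y ∘ suc) i
code (suc c) y zero    = l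
code (suc c) y (suc i) = code c y i

-- The equation splits the current block into c′ letters already read and c letters still to come.
Codes-code : ∀ i c c′ y → y 0 ≡ c′ ℕ.+ c → Codes c′ y (prefix (code c (y ∘ suc)) i)
Codes-code zero    c       c′ y e = _
Codes-code (suc i) zero    c′ y e =
  trans e (ℕₚ.+-identityʳ c′) , Codes-code i (y 1) 0 (y ∘ suc) refl
Codes-code (suc i) (suc c) c′ y e =
  Codes-code i c (suc c′) y (trans e (ℕₚ.+-suc c′ c))

Inf-r-code : ∀ c y → Inf r (code c y)
Inf-r-code c       y zero    = c , z≤n , at c
  where
  at : ∀ c → code c y c ≡ r
  at zero    = refl
  at (suc c) = at c
Inf-r-code zero    y (suc n) with m , n≤m , e ← Inf-r-code (y 0) (y ∘ suc) n =
  suc m , s≤s n≤m , e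
Inf-r-code (suc c) y (suc n) with m , n≤m , e ← Inf-r-code c y n = suc m , s≤s n≤m , e

-- Decoding a branch into a point of Baire space

FirstR : ℕ → (ℕ → Direction) → Set
FirstR zero    d = d 0 ≡ r
FirstR (suc c) d = d 0 ≡ l × FirstR c (d ∘ suc)

firstR : ∀ m d → d m ≡ r → ∃[ c ] FirstR c d
firstR zero    d e = 0 , e
firstR (suc m) d e with d 0 in e₀
... | r = 0 , e₀
... | l with c , p ← firstR m (d ∘ suc) e = suc c , e₀ , p

drop : ℕ → (ℕ → Direction) → ℕ → Direction
drop c d i = d (c ℕ.+ i)

Inf-drop : ∀ c {d} → Inf r d → Inf r (drop c d)
Inf-drop zero    inf = inf
Inf-drop (suc c) inf = Inf-drop c (Inf-tail inf)

firstBlock : ∀ d → Inf r d → ∃[ c ] FirstR c d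
firstBlock d inf with m , _ , e ← inf 0 = firstR m d e

decode : (d : ℕ → Direction) → Inf r d → ℕ → ℕ
decode d inf zero    = proj₁ (firstBlock d inf)
decode d inf (suc i) with c , _ ← firstBlock d inf =
  decode (drop (suc c) d) (Inf-drop (suc c) inf) i

Codes-split : ∀ c d c′ y m → FirstR c d → Codes c′ y (prefix d (suc c ℕ.+ m)) →
              y 0 ≡ c′ ℕ.+ c × Codes 0 (y ∘ suc) (prefix (drop (suc c) d) m)
Codes-split zero    d c′ y m e p rewrite e with q , q′ ← p =
  trans q (sym (ℕₚ.+-identityʳ c′)) , q′
Codes-split (suc c) d c′ y m (e , first) p rewrite e
  with q , q′ ← Codes-split c (d ∘ suc) (suc c′) y m first p =
  trans q (sym (ℕₚ.+-suc c′ c)) , q′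

-- N is the total length of the first K blocks of d, closing r's included; a prefix at least that
-- long determines the first K coded values.
decode-unique : ∀ K d inf → ∃[ N ] (∀ m y → Codes 0 y (prefix d (N ℕ.+ m)) →
                Agree K (decode d inf) y)
decode-unique zero    d inf = 0 , λ _ _ _ _ ()
decode-unique (suc K) d inf with firstBlock d inf in eq
... | c , first with N , h ← decode-unique K (drop (suc c) d) (Inf-drop (suc c) inf) =
  suc c ℕ.+ N , unique
  where
  unique : ∀ m y → Codes 0 y (prefix d (suc c ℕ.+ N ℕ.+ m)) → Agree (suc K) (decode d inf) y
  unique m y p i i<K
    with q , q′ ← Codes-split c d 0 y (N ℕ.+ m) first
                    (subst (Codes 0 y ∘ prefix d) (ℕₚ.+-assoc (suc c) N m) p)
    with i | i<K
  ... | zero   | _ = trans (cong proj₁ eq) (sym q)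
  ... | suc i′ | s≤s i′<K rewrite eq = h m (y ∘ suc) q′ i′ i′<K

-- The search tree of a closed set

module Hardness (em : ExcludedMiddle 0ℓ) where
  open Classical em

  indicator : Set → Fin 2
  indicator P with em {P}
  ... | yes _ = 1F
  ... | no _  = 0F

  indicator-true : ∀ {P} → P → indicator P ≡ 1F
  indicator-true {P} p with em {P}
  ... | yes _ = refl
  ... | no np = contradiction p np

  indicator-true⁻¹ : ∀ {P} → indicator P ≡ 1F → P
  indicator-true⁻¹ {P} e with em {P}
  ... | yes p = p
  ... | no _ with () ← e

  indicator-cong : ∀ {P Q} → (P → Q) → (Q → P) → indicator P ≡ indicator Q
  indicator-cong {P} {Q} f g with em {P} | em {Q}
  ... | yes _ | yes _ = refl
  ... | no _  | no _  = refl
  ... | yes p | no nq = contradiction (f p) nq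
  ... | no np | yes q = contradiction (g q) np

  module _ {A : Set} (C : Pred (Point (Words A ⊗ Baire)) 0ℓ)
           (closed : IsClosed (Words A ⊗ Baire) C) where

    -- Ending in r makes every branch with infinitely many 1s code a point of Baire space. The
    -- witness (x′, y) may change with u; closedness of `C` later turns these approximations into a
    -- point over x.
    Live : (ℕ → A) → Node → Set
    Live x u = (∃[ v ] u ≡ v ∷ʳ r) ×
      (∃[ x′ ] ∃[ y ] (C (x′ , y) × Agree (length u) x x′ × Codes 0 y u))

    searchTree : (ℕ → A) → Tree (Fin 2)
    searchTree x u = indicator (Live x u)

    searchTree-local : Local searchTree
    searchTree-local u x x′ agree = indicator-cong
      (λ { (e , z , y , c , a , p) → e , z , y , c , (λ i q → trans (sym (agree i q)) (a i q)) , p })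
      (λ { (e , z , y , c , a , p) → e , z , y , c , (λ i q → trans (agree i q) (a i q)) , p })

    projection⇒𝓛 : ∀ x y → C (x , y) → 𝓛 (searchTree x)
    projection⇒𝓛 x y c = directions⇒𝓛 {searchTree x} d inf
      where
      d = code (y 0) (y ∘ suc)
      inf : Inf 1F (searchTree x ∘ prefix d)
      inf n with m , n≤m , e ← Inf-r-code (y 0) (y ∘ suc) n =
        suc m , ℕₚ.m≤n⇒m≤1+n n≤m , indicator-true
          ((prefix d m , trans (prefix-∷ʳ d m) (cong (prefix d m ∷ʳ_) e)) ,
           x , y , c , (λ _ _ → refl) , Codes-code (suc m) (y 0) 0 y refl)

    -- Were the decoded point not in the fibre of `C` over x, a basic neighbourhood would avoid `C`;
    -- a deep enough live node on the branch gives a point of `C` inside it.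
    𝓛⇒projection : ∀ x → 𝓛 (searchTree x) → ∃[ y ] C (x , y)
    𝓛⇒projection x t∈𝓛 with d , inf ← 𝓛⇒directions {searchTree x} t∈𝓛 = decode d inf-r , dne contra
      where
      live : ∀ n → ∃[ m ] (n ℕ.≤ m × Live x (prefix d m))
      live n with m , n≤m , e ← inf n = m , n≤m , indicator-true⁻¹ e
      inf-r : Inf r d
      inf-r n with live (suc n)
      ... | suc m , s≤s n≤m , (v , e) , _ =
        m , n≤m , ∷ʳ-injectiveʳ (prefix d m) v (trans (sym (prefix-∷ʳ d m)) e)
      contra : ¬ ¬ C (x , decode d inf-r)
      contra nc with (bx , by) , (x∈ , y∈) , avoid ← closed (x , decode d inf-r) nc
        with K , near-x ← Agree⇒∈ bx x∈
        with K′ , near-y ← Agree⇒∈ by y∈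
        with N , unique ← decode-unique K′ d inf-r
        -- Depth N fixes the first K′ values of y′, and depth K the first K letters of x′.
        with m , le , _ , x′ , y′ , c , agree , codes ← live (N ℕ.+ K) =
        avoid (x′ , y′)
          ( near-x x′ (Agree-≤ K≤ agree)
          , near-y y′ (unique (m ℕ.∸ N) y′ (subst (Codes 0 y′ ∘ prefix d)
              (sym (ℕₚ.m+[n∸m]≡n (ℕₚ.m+n≤o⇒m≤o N le))) codes)))
          c
        where
        K≤ : K ℕ.≤ length (prefix d m)
        K≤ = subst (K ℕ.≤_) (sym (length-prefix d m)) (ℕₚ.m+n≤o⇒n≤o N le)

-- Completeness of 𝓛ₙ

takeVec : ∀ k → (ℕ → ℕ) → Vec ℕ k
takeVec zero    y = []
takeVec (suc k) y = y 0 ∷ takeVec k (y ∘ suc)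

prepend : ∀ {k} → Vec ℕ k → (ℕ → ℕ) → ℕ → ℕ
prepend []       y i       = y i
prepend (m ∷ as) y zero    = m
prepend (m ∷ as) y (suc i) = prepend as y i

takeVec-prepend : ∀ {k} (a : Vec ℕ k) y → takeVec k (prepend a y) ≡ a
takeVec-prepend []       y = refl
takeVec-prepend (m ∷ as) y = cong (m ∷_) (takeVec-prepend as y)

prepend-+ : ∀ {k} (a : Vec ℕ k) y i → prepend a y (k ℕ.+ i) ≡ y i
prepend-+ []       y i = refl
prepend-+ (m ∷ as) y i = prepend-+ as y i

takeVec-local : ∀ k {y y′} → Agree k y y′ → takeVec k y′ ≡ takeVec k y
takeVec-local zero    h = refl
takeVec-local (suc k) h =
  cong₂ _∷_ (sym (h 0 (s≤s z≤n))) (takeVec-local k (λ i p → h (suc i) (s≤s p)))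

double : ℕ → ℕ
double zero    = zero
double (suc i) = suc (suc (double i))

double-mono-< : ∀ {i j} → i ℕ.< j → double i ℕ.< double j
double-mono-< {zero}  (s≤s p) = s≤s z≤n
double-mono-< {suc i} (s≤s p) = s≤s (s≤s (double-mono-< p))

interleave : (ℕ → ℕ) → (ℕ → ℕ) → ℕ → ℕ
interleave y z zero          = y 0
interleave y z (suc zero)    = z 0
interleave y z (suc (suc i)) = interleave (y ∘ suc) (z ∘ suc) i

interleave-even : ∀ y z i → interleave y z (double i) ≡ y i
interleave-even y z zero    = refl
interleave-even y z (suc i) = interleave-even (y ∘ suc) (z ∘ suc) i

interleave-odd : ∀ y z i → interleave y z (suc (double i)) ≡ z i
interleave-odd y z zero    = refl
interleave-odd y z (suc i) = interleave-odd (y ∘ suc) (z ∘ suc) i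

toDirection : ℕ → Direction
toDirection zero    = l
toDirection (suc _) = r

fromDirection : Direction → ℕ
fromDirection l = 0
fromDirection r = 1

toDirection-fromDirection : ∀ d → toDirection (fromDirection d) ≡ d
toDirection-fromDirection l = refl
toDirection-fromDirection r = refl

-- A point of Baire space consists of k coefficients, followed by two
-- interleaved sequences: the directions of a branch, and for each i a position
-- m ≥ i on it.
module Certificate (k : ℕ) where

  directions : (ℕ → ℕ) → ℕ → Direction
  directions y i = toDirection (y (k ℕ.+ double i))

  position : (ℕ → ℕ) → ℕ → ℕ
  position y i = y (k ℕ.+ suc (double i))

  visited : (ℕ → ℕ) → ℕ → Node
  visited y i = address (takeVec k y) ++ prefix (directions y) (position y i)

  visited-local : ∀ y i → ∃[ N ] (∀ y′ → Agree N y y′ →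
                  position y′ i ≡ position y i × visited y′ i ≡ visited y i)
  visited-local y i = M ℕ.+ N , λ y′ agree →
    let agree-M = Agree-≤ (ℕₚ.m≤m+n M N) agree
        agree-N = Agree-≤ (ℕₚ.m≤n+m N M) agree
        pos     = sym (agree-M (k ℕ.+ suc (double i)) ℕₚ.≤-refl)
    in pos , cong₂ _++_
         (cong address (takeVec-local k (Agree-≤ (ℕₚ.m≤m+n k _) agree-N)))
         (trans (cong (prefix (directions y′)) pos)
           (prefix-cong (position y i) λ j j< → cong toDirection
             (sym (agree-N _ (ℕₚ.+-monoʳ-< k (double-mono-< j<))))))
    where
    -- M covers the coordinate that holds the position; N covers the coefficients and all directions
    -- before that position.
    M = suc (k ℕ.+ suc (double i))
    N = k ℕ.+ double (position y i)

  certificate : Vec ℕ k → (ℕ → Direction) → (ℕ → ℕ) → ℕ → ℕ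
  certificate a d w = prepend a (interleave (fromDirection ∘ d) w)

  position-certificate : ∀ a d w i → position (certificate a d w) i ≡ w i
  position-certificate a d w i =
    trans (prepend-+ a _ (suc (double i))) (interleave-odd _ w i)

  visited-certificate : ∀ a d w i →
                        visited (certificate a d w) i ≡ address a ++ prefix d (w i)
  visited-certificate a d w i = cong₂ _++_
    (cong address (takeVec-prepend a _))
    (trans (prefix-cong _ λ j _ → trans
             (cong toDirection (trans (prepend-+ a _ (double j)) (interleave-even _ w j)))
             (toDirection-fromDirection (d j)))
           (cong (prefix d) (position-certificate a d w i)))

-- The clause of `𝓛ₙ` for n ≥ 2, used for all n = k + 1 so that n = 1 is no longer a special case.
𝓛Ord : (k : ℕ) → Pred (Tree (Fin 2)) 0ℓ
𝓛Ord k t =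
  Σ[ a ∈ Vec ℕ (suc k) ]
    ( (𝓛 (subtree t (address a)) × Odd (Ord a))
    × (∀ (b : Vec ℕ (suc k)) → Ord b <ₒ Ord a → ¬ 𝓛 (subtree t (address b))))

module Completeness (em : ExcludedMiddle 0ℓ) where
  open Classical em
  open Hardness em

  𝓛ₙ≐𝓛Ord : ∀ k → 𝓛ₙ (suc k) ≐ 𝓛Ord k
  𝓛ₙ≐𝓛Ord zero =
    (λ (m , t∈𝓛 , least , odd) →
      m ∷ [] , (t∈𝓛 , 2∤last⇒Odd-Ord (m ∷ []) odd) ,
      λ { (m′ ∷ []) p → least m′ (fromℕ-cancel-≤ p) }) ,
    (λ { (m ∷ [] , (t∈𝓛 , odd) , least) →
      m , t∈𝓛 , (λ m′ p → least (m′ ∷ []) (fromℕ-mono-≤ p)) ,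
      Odd-Ord⇒2∤last (m ∷ []) odd })
  𝓛ₙ≐𝓛Ord (suc k) = (λ t∈ → t∈) , (λ t∈ → t∈)

  -- Continuous preimages of `𝓛Ord` lie in the difference class

  module _ (X : Space) (k : ℕ) (f : Point X → Tree (Fin 2))
           (f-continuous : Continuous X (Trees (Fin 2)) f) where

    open Certificate (suc k)

    Reached : Ordinal → Pred (Point X) 0ℓ
    Reached θ x = ∃[ a ] (Ord {k} a ≤ₒ θ × 𝓛 (subtree (f x) (address a)))

    Reached-mono : ∀ {θ θ′ x} → θ ≤ₒ θ′ → Reached θ x → Reached θ′ x
    Reached-mono p (a , q , t∈𝓛) = a , ≤ₒ-trans q p , t∈𝓛

    Certifies : Ordinal → Pred (Point (X ⊗ Baire)) 0ℓ
    Certifies θ (x , y) =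
      Ord (takeVec (suc k) y) ≤ₒ θ × (∀ i → i ℕ.≤ position y i × f x (visited y i) ≡ 1F)

    Certifies-closed : ∀ θ → IsClosed (X ⊗ Baire) (Certifies θ)
    Certifies-closed θ (x , y) ¬cert with em {Ord (takeVec (suc k) y) ≤ₒ θ}
    -- Here y alone refutes membership. A basic neighbourhood of x is still required, and continuity
    -- applied to the whole tree space supplies one.
    ... | no ¬p with b , x∈b , _ ← f-continuous (λ _ → ⊤) (λ _ _ → [] , [] , _) x _ =
      (b , cylinder y (suc k)) , (x∈b , ∈-cylinder y (suc k)) ,
      λ { (_ , y′) (_ , y′∈) (p , _) → ¬p (subst (λ a → Ord a ≤ₒ θ)
            (takeVec-local (suc k) (∈-cylinder⇒Agree (suc k) y′∈)) p) }
    -- Some requirement i fails; it involves finitely many coordinates of y and a single label of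
    -- the tree, so its failure is an open condition.
    ... | yes p with i , ¬q ← ¬∀⇒∃¬ (λ q → ¬cert (p , q))
      with N , loc ← visited-local y i
      with b , x∈b , b⊆ ← f-continuous
             (λ t → ¬ (i ℕ.≤ position y i × t (visited y i) ≡ 1F))
             (λ t h → (visited y i , t (visited y i)) ∷ [] , refl ∷ [] ,
                λ { t′ (e ∷ []) (i≤ , e′) → h (i≤ , trans (sym e) e′) })
             x ¬q =
      (b , cylinder y N) , (x∈b , ∈-cylinder y N) , refute
      where
      refute : ∀ z → Space._∈ᵇ_ (X ⊗ Baire) z (b , cylinder y N) → ¬ Certifies θ z
      refute (x′ , y′) (x′∈ , y′∈) (_ , q) with pos , vis ← loc y′ (∈-cylinder⇒Agree N y′∈) =
        b⊆ x′ x′∈ (subst (i ℕ.≤_) pos (proj₁ (q i)) ,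
                   trans (cong (f x′) (sym vis)) (proj₂ (q i)))

    Reached-analytic : ∀ θ → Analytic X (Reached θ)
    Reached-analytic θ = Certifies θ , Certifies-closed θ , to , from
      where
      to : ∀ {x} → Reached θ x → ∃[ y ] Certifies θ (x , y)
      to {x} (a , p , t∈𝓛) with d , inf ← 𝓛⇒directions {subtree (f x) (address a)} t∈𝓛 =
        certificate a d w ,
        subst (λ a → Ord a ≤ₒ θ) (sym (takeVec-prepend a _)) p ,
        λ i → subst (i ℕ.≤_) (sym (position-certificate a d w i)) (proj₁ (proj₂ (inf i))) ,
              trans (cong (f x) (visited-certificate a d w i)) (proj₂ (proj₂ (inf i)))
        where
        w : ℕ → ℕ
        w i = proj₁ (inf i)
      from : ∀ {x} → ∃[ y ] Certifies θ (x , y) → Reached θ x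
      from {x} (y , p , q) = takeVec (suc k) y , p ,
        directions⇒𝓛 {subtree (f x) _} (directions y) λ i → position y i , q i

    -- The first stage reached is `Ord a` for the least address a with subtree in `𝓛`; as ω^(k+1) is
    -- even, `D` selects the odd stages.
    preimage≐D : (f ⊢ 𝓛Ord k) ≐ D (ω^ (suc k)) Reached
    preimage≐D =
      (λ (a , (t∈𝓛 , odd) , least) →
        Ord a , Ord<ω^ a , (a , ≤ₒ-refl , t∈𝓛) ,
        (λ θ p (b , q , t′∈𝓛) → least b (≤-<ₒ-trans q p) t′∈𝓛) ,
        inj₂ (odd , Even-ω^ k)) ,
      λ { (θ , _ , _ , _ , inj₁ (_ , odd)) → contradiction (Even-ω^ k) odd
        ; (θ , _ , (a , p , t∈𝓛) , least , inj₂ (odd , _)) →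
            a , (t∈𝓛 , Odd-resp-≈ₒ (θ≤Ord least a t∈𝓛 , p) odd) ,
            λ b q t′∈𝓛 → least (Ord b) (≤ₒ-trans q p) (b , ≤ₒ-refl , t′∈𝓛) }
      where
      θ≤Ord : ∀ {θ x} → (∀ θ′ → θ′ <ₒ θ → ¬ Reached θ′ x) →
              ∀ a → 𝓛 (subtree (f x) (address a)) → θ ≤ₒ Ord a
      θ≤Ord {θ} least a t∈𝓛 with ≤ₒ-or->ₒ θ (Ord a)
      ... | inj₁ p = p
      ... | inj₂ p = contradiction (a , ≤ₒ-refl , t∈𝓛) (least (Ord a) p)

  -- Reduction of a difference set to `𝓛Ord`

  module _ {A : Set} (k : ℕ) (F : Ordinal → Pred (ℕ → A) 0ℓ)
           (analytic : ∀ θ → θ <ₒ ω^ (suc k) → Analytic (Words A) (F θ))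
           (increasing : Increasing (ω^ (suc k)) F) where

    reduction : (ℕ → A) → Tree (Fin 2)
    reduction x = graft (suc k) 0F λ a →
      let C , closed , _ = analytic (Ord a) (Ord<ω^ a) in searchTree C closed x

    reduction-local : Local reduction
    reduction-local u x x′ agree = graft-cong (suc k) 0F u λ a v p →
      let C , closed , _ = analytic (Ord a) (Ord<ω^ a)
      in searchTree-local C closed v x x′ (Agree-≤ p agree)

    F⇒𝓛 : ∀ {x} a → F (Ord a) x → 𝓛 (subtree (reduction x) (address a))
    F⇒𝓛 {x} a x∈F =
      let C , closed , to , _ = analytic (Ord a) (Ord<ω^ a)
          y , c = to x∈F
      in 𝓛-cong (λ u → sym (subtree-graft (suc k) 0F _ a u)) (projection⇒𝓛 C closed x y c)

    𝓛⇒F : ∀ {x} a → 𝓛 (subtree (reduction x) (address a)) → F (Ord a) x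
    𝓛⇒F {x} a t∈𝓛 =
      let C , closed , _ , from = analytic (Ord a) (Ord<ω^ a)
      in from (𝓛⇒projection C closed x (𝓛-cong (subtree-graft (suc k) 0F _ a) t∈𝓛))

    -- The grafted tree sees only the stages `Ord a`. By `Ord-surjective` these are all stages up to
    -- notation, and monotonicity of `F` passes between notations of one ordinal.
    D≐preimage : D (ω^ (suc k)) F ≐ (reduction ⊢ 𝓛Ord k)
    D≐preimage =
      (λ { (_ , _ , _ , _ , inj₁ (_ , odd)) → contradiction (Even-ω^ k) odd
         ; (θ , θ<ω , x∈F , least , inj₂ (odd , _)) →
             let a , θ≈@(θ≤ , ≤θ) = Ord-surjective k θ<ω in
             a , (F⇒𝓛 a (increasing θ (Ord a) θ≤ (Ord<ω^ a) x∈F) , Odd-resp-≈ₒ θ≈ odd) ,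
             λ b p t∈𝓛 → least (Ord b) (≤ₒ-trans p ≤θ) (𝓛⇒F b t∈𝓛) }) ,
      λ (a , (t∈𝓛 , odd) , least) →
        Ord a , Ord<ω^ a , 𝓛⇒F a t∈𝓛 ,
        (λ θ p x∈F →
          let b , θ≤ , ≤θ = Ord-surjective k (≤ₒ-trans p (<ₒ⇒≤ₒ (Ord<ω^ a))) in
          least b (≤-<ₒ-trans ≤θ p) (F⇒𝓛 b (increasing θ (Ord b) θ≤ (Ord<ω^ b) x∈F))) ,
        inj₂ (odd , Even-ω^ k)

  𝓛ₙ-complete : ∀ k → DΣ¹₁-Complete (ω^ (suc k)) (Trees (Fin 2)) (𝓛ₙ (suc k))
  𝓛ₙ-complete k s E = mk⇔
    (λ (F , analytic , increasing , E≐D) →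
      reduction k F analytic increasing ,
      Local⇒Continuous (reduction-local k F analytic increasing) ,
      ≐-trans E≐D (≐-trans (D≐preimage k F analytic increasing)
        (proj₂ (𝓛ₙ≐𝓛Ord k) , proj₁ (𝓛ₙ≐𝓛Ord k))))
    (λ (f , continuous , E≐) →
      Reached (Words (Fin s)) k f continuous ,
      (λ θ _ → Reached-analytic (Words (Fin s)) k f continuous θ) ,
      (λ _ _ p _ → Reached-mono (Words (Fin s)) k f continuous p) ,
      ≐-trans E≐ (≐-trans (proj₁ (𝓛ₙ≐𝓛Ord k) , proj₂ (𝓛ₙ≐𝓛Ord k))
        (preimage≐D (Words (Fin s)) k f continuous)))

-- The Muller automaton

-- p is the parity of the part of the first block that has been read already.
OddFrom : ∀ {k} → Bool → Vec ℕ (suc k) → Set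
OddFrom p (suc m ∷ as)         = OddFrom (not p) (m ∷ as)
OddFrom p (zero  ∷ [])         = T p
OddFrom p (zero  ∷ as@(_ ∷ _)) = OddFrom false as

OddFrom⇔2∤last : ∀ {k} (a : Vec ℕ (suc k)) → OddFrom false a ⇔ (¬ 2 ∣ last a)
OddFrom⇔2∤last (zero        ∷ [])     = mk⇔ (λ ()) (λ h → h (2 ∣0))
OddFrom⇔2∤last (suc zero    ∷ [])     = mk⇔ (λ _ → >⇒∤ (s≤s (s≤s z≤n))) _
OddFrom⇔2∤last (suc (suc m) ∷ [])     with OddFrom⇔2∤last (m ∷ [])
... | e = mk⇔ (λ odd 2∣ → Equivalence.to e odd (∣m+n∣m⇒∣n 2∣ ∣-refl))
              (λ 2∤ → Equivalence.from e (λ 2∣ → 2∤ (∣m∣n⇒∣m+n ∣-refl 2∣)))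
OddFrom⇔2∤last (zero ∷ as@(_ ∷ _))        = OddFrom⇔2∤last as
OddFrom⇔2∤last (suc zero ∷ as@(_ ∷ _))    = OddFrom⇔2∤last as
OddFrom⇔2∤last (suc (suc m) ∷ as@(_ ∷ _)) = OddFrom⇔2∤last (m ∷ as)

child : {A : Set} → Direction → Tree A → Tree A
child e t u = t (e ∷ u)

Clean : ℕ → Tree (Fin 2) → Set
Clean j t = (a : Vec ℕ j) → ¬ 𝓛 (subtree t (address a))

First : ℕ → Bool → Tree (Fin 2) → Set
First j p t = Σ[ a ∈ Vec ℕ (suc j) ]
  (𝓛 (subtree t (address a)) × OddFrom p a × (∀ b → b <ₗ a → ¬ 𝓛 (subtree t (address b))))

-- A smaller address either starts with r, and `clean` excludes it, or starts with l and is already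
-- smaller in the left child.
First-l : ∀ {j p t} → Clean j (child r t) → First j (not p) (child l t) → First j p t
First-l {t = t} clean (m ∷ as , t∈𝓛 , odd , least) = suc m ∷ as , t∈𝓛 , odd , λ
  { (zero  ∷ bs) _               → clean bs
  ; (suc m′ ∷ bs) (here (s≤s p)) → least (m′ ∷ bs) (here p)
  ; (suc m′ ∷ bs) (there p)      → least (m′ ∷ bs) (there p) }

First-r : ∀ {j p t} → First j false (child r t) → First (suc j) p t
First-r (as@(_ ∷ _) , t∈𝓛 , odd , least) = 0 ∷ as , t∈𝓛 , odd , λ
  { (zero ∷ bs) (there p) → least bs p }

First-zero : ∀ {t} → 𝓛 (child r t) → First 0 true t
First-zero t∈𝓛 = 0 ∷ [] , t∈𝓛 , _ , λ { (zero ∷ []) (there ()) }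

-- In state `main j p` the automaton guesses the rest of the address a, which
-- has j + 1 further blocks; p is the parity of the current block. In state
-- `check j _` the subtrees below all addresses with j blocks have to be outside
-- 𝓛, where `check 0 c` also records the last letter c read. In state `search c`
-- it guesses a branch with infinitely many 1s, and c is the last letter read.
State : ℕ → Set
State n = (Fin n × Bool) ⊎ (Fin n × Fin 2) ⊎ Fin 2 ⊎ ⊤

pattern main j p  = inj₁ (j , p)
pattern check j c = inj₂ (inj₁ (j , c))
pattern search c  = inj₂ (inj₂ (inj₁ c))
pattern any       = inj₂ (inj₂ (inj₂ tt))

size : ℕ → ℕ
size n = n ℕ.* 2 ℕ.+ (n ℕ.* 2 ℕ.+ (2 ℕ.+ 1))

State↔Fin : ∀ n → Fin (size n) ↔ State n
State↔Fin n =
  ((↔-id _ ×-↔ 2↔Bool) ↔-∘ *↔×) ⊎↔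
  (*↔× ⊎↔
  (↔-id _ ⊎↔ 1↔⊤))
  where
  infixr 1 _⊎↔_
  _⊎↔_ : ∀ {i j} {A B : Set} → Fin i ↔ A → Fin j ↔ B → Fin (i ℕ.+ j) ↔ (A ⊎ B)
  f ⊎↔ g = (f ⊎-↔ g) ↔-∘ +↔⊎

module _ {n : ℕ} where

  -- After `main-l` the right subtree holds only addresses smaller than the guess and must be
  -- checked; after `main-r` or `main-search` the left one holds only larger addresses. On entering
  -- `check` or `search`, the letter 0 is a mere default.
  data Step : State (suc n) → Fin 2 → State (suc n) → State (suc n) → Set where
    main-l      : ∀ {j p c} → Step (main j p) c (main j (not p)) (check j 0F)
    main-r      : ∀ {j p c} → Step (main (suc j) p) c any (main (inject₁ j) false)
    main-search : ∀ {c}     → Step (main zero true) c any (search 0F)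
    check-suc   : ∀ {j c c′} → Step (check (suc j) c) c′ (check (suc j) 0F) (check (inject₁ j) 0F)
    check-zero  : ∀ {c c′}  → Step (check zero c) c′ (check zero c′) (check zero c′)
    search-l    : ∀ {c c′}  → Step (search c) c′ (search c′) any
    search-r    : ∀ {c c′}  → Step (search c) c′ any (search c′)
    any-any     : ∀ {c}     → Step any c any any

  -- `main j false` need not be excluded: a run that guesses l forever alternates
  -- between both parities.
  GoodSet : (State (suc n) → Set) → Set
  GoodSet S = (∀ j → ¬ S (main j true)) × ¬ S (check zero 1F) × (S (search 0F) → S (search 1F))

  GoodSet-resp : ∀ {S S′} → (∀ q → S q ⇔ S′ q) → GoodSet S → GoodSet S′
  GoodSet-resp e (m , c , s) =
    (λ j x → m j (Equivalence.from (e _) x)) , (λ x → c (Equivalence.from (e _) x)) ,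
    λ x → Equivalence.to (e _) (s (Equivalence.from (e _) x))

  Good : (ℕ → State (suc n)) → Set
  Good w = GoodSet (λ q → Inf q w)

  Good-tail : ∀ {w} → Good w → Good (w ∘ suc)
  Good-tail {w} = GoodSet-resp (λ q → mk⇔ (Inf-tail {a = q} {w}) (Inf-untail {a = q} {w}))

  Good-untail : ∀ {w} → Good (w ∘ suc) → Good w
  Good-untail {w} = GoodSet-resp (λ q → mk⇔ (Inf-untail {a = q} {w}) (Inf-tail {a = q} {w}))

  _◂_ : Direction → (ℕ → Direction) → ℕ → Direction
  (e ◂ d) zero    = e
  (e ◂ d) (suc i) = d i

  -- Accepting runs and their decomposition at the root

  record Run (q : State (suc n)) (t : Tree (Fin 2)) (ρ : Tree (State (suc n))) : Set where
    field
      start : ρ [] ≡ q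
      step  : ∀ u → Step (ρ u) (t u) (ρ (u ∷ʳ l)) (ρ (u ∷ʳ r))
      good  : ∀ d → Good (ρ ∘ prefix d)

  AcceptedFrom : State (suc n) → Tree (Fin 2) → Set
  AcceptedFrom q t = ∃[ ρ ] Run q t ρ

  join : ∀ {q q₁ q₂ t} → Step q (t []) q₁ q₂ →
         AcceptedFrom q₁ (child l t) → AcceptedFrom q₂ (child r t) → AcceptedFrom q t
  join {q} {t = t} s (ρ₁ , R₁) (ρ₂ , R₂) = ρ , record
    { start = refl ; step = step ; good = λ d → Good-untail {ρ ∘ prefix d} (good (d 0) (d ∘ suc)) }
    where
    ρ : Tree (State (suc n))
    ρ []      = q
    ρ (l ∷ u) = ρ₁ u
    ρ (r ∷ u) = ρ₂ u
    step : ∀ u → Step (ρ u) (t u) (ρ (u ∷ʳ l)) (ρ (u ∷ʳ r))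
    step []      rewrite Run.start R₁ | Run.start R₂ = s
    step (l ∷ u) = Run.step R₁ u
    step (r ∷ u) = Run.step R₂ u
    good : ∀ e d → Good (λ i → ρ (e ∷ prefix d i))
    good l = Run.good R₁
    good r = Run.good R₂

  split : ∀ {q t ρ} → Run q t ρ → ∃[ q₁ ] ∃[ q₂ ]
          (Step q (t []) q₁ q₂ × Run q₁ (child l t) (child l ρ) × Run q₂ (child r t) (child r ρ))
  split {q} {t} {ρ} R = _ , _ ,
    subst (λ q → Step q (t []) (ρ (l ∷ [])) (ρ (r ∷ []))) (Run.start R) (Run.step R []) ,
    sub l , sub r
    where
    sub : ∀ e → Run (ρ (e ∷ [])) (child e t) (child e ρ)
    sub e = record
      { start = refl
      ; step  = λ u → Run.step R (e ∷ u)
      ; good  = λ d → Good-tail {ρ ∘ prefix (e ◂ d)} (Run.good R (e ◂ d))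
      }

  any-accepts : ∀ t → AcceptedFrom any t
  any-accepts t = (λ _ → any) , record
    { start = refl
    ; step  = λ _ → any-any
    ; good  = λ d → (λ j inf → absurd inf λ ()) , (λ inf → absurd inf λ ()) , λ inf → absurd inf λ ()
    }
    where
    absurd : ∀ {A B : Set} {q : A} {w} → Inf q w → (∀ {i} → ¬ w i ≡ q) → B
    absurd inf h with m , _ , e ← inf 0 = contradiction e (h {m})

  -- Runs from `check` states, where the automaton is deterministic

  sweep : Fin (suc n) → Fin 2 → Tree (Fin 2) → Tree (State (suc n))
  sweep j       c t []      = check j c
  sweep zero    c t (e ∷ u) = sweep zero (t []) (child e t) u
  sweep (suc j) c t (l ∷ u) = sweep (suc j) 0F (child l t) u
  sweep (suc j) c t (r ∷ u) = sweep (inject₁ j) 0F (child r t) u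

  sweep-step : ∀ j c t u → Step (sweep j c t u) (t u) (sweep j c t (u ∷ʳ l)) (sweep j c t (u ∷ʳ r))
  sweep-step zero    c t []      = check-zero
  sweep-step (suc j) c t []      = check-suc
  sweep-step zero    c t (e ∷ u) = sweep-step zero (t []) (child e t) u
  sweep-step (suc j) c t (l ∷ u) = sweep-step (suc j) 0F (child l t) u
  sweep-step (suc j) c t (r ∷ u) = sweep-step (inject₁ j) 0F (child r t) u

  sweep-check : ∀ j c t u → ∃[ j′ ] ∃[ c′ ] sweep j c t u ≡ check j′ c′
  sweep-check j       c t []      = j , c , refl
  sweep-check zero    c t (e ∷ u) = sweep-check zero (t []) (child e t) u
  sweep-check (suc j) c t (l ∷ u) = sweep-check (suc j) 0F (child l t) u
  sweep-check (suc j) c t (r ∷ u) = sweep-check (inject₁ j) 0F (child r t) u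

  sweep-label : ∀ c t d i → sweep zero c t (prefix d (suc i)) ≡ check zero (t (prefix d i))
  sweep-label c t d zero    = refl
  sweep-label c t d (suc i) = sweep-label (t []) (child (d 0) t) (d ∘ suc) i

  check-injective : ∀ {j} {c c′ : Fin 2} → _≡_ {A = State (suc n)} (check j c) (check j c′) → c ≡ c′
  check-injective refl = refl

  search-injective : ∀ {c c′ : Fin 2} → _≡_ {A = State (suc n)} (search c) (search c′) → c ≡ c′
  search-injective refl = refl

  -- One visit to `check zero 1F` at time i bounds the descent to level 0; from there on, infinitely
  -- many visits mean infinitely many 1s below an address.
  sweep-avoids : ∀ i k j c t d → toℕ j ≡ k → Clean k t →
                 sweep j c t (prefix d i) ≡ check zero 1F →
                 ¬ Inf (check zero 1F) (sweep j c t ∘ prefix d)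
  sweep-avoids i zero zero c t d refl clean _ inf =
    clean [] (directions⇒𝓛 {t} d (λ k →
      let m , k≤m , e = Inf-tail {w = sweep zero c t ∘ prefix d} inf k
      in m , k≤m , check-injective (trans (sym (sweep-label c t d m)) e)))
  sweep-avoids zero    (suc k) (suc j) c t d e clean () inf
  sweep-avoids (suc i) (suc k) (suc j) c t d e clean at inf
    with d 0 | Inf-tail {w = sweep (suc j) c t ∘ prefix d} inf
  ... | l | inf′ = sweep-avoids i (suc k) (suc j) 0F (child l t) (d ∘ suc) e
                     (λ { (m ∷ as) → clean (suc m ∷ as) }) at inf′
  ... | r | inf′ = sweep-avoids i k (inject₁ j) 0F (child r t) (d ∘ suc)
                     (trans (toℕ-inject₁ j) (ℕₚ.suc-injective e)) (λ as → clean (0 ∷ as)) at inf′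

  check-complete : ∀ j {k} c t → toℕ j ≡ k → Clean k t → AcceptedFrom (check j c) t
  check-complete j {k} c t e clean = sweep j c t , record
    { start = start j ; step = sweep-step j c t ; good = good }
    where
    start : ∀ j → sweep j c t [] ≡ check j c
    start zero    = refl
    start (suc j) = refl
    only-check : ∀ {q d} → (∀ {j c} → ¬ check j c ≡ q) → ¬ Inf q (sweep j c t ∘ prefix d)
    only-check {d = d} h inf with m , _ , e ← inf 0 with _ , _ , e′ ← sweep-check j c t (prefix d m) =
      h (trans (sym e′) e)
    good : ∀ d → Good (sweep j c t ∘ prefix d)
    good d = (λ _ → only-check {d = d} λ ()) ,
             (λ inf → let i , _ , at = inf 0 in sweep-avoids i k j c t d e clean at inf) ,
             λ inf → ⊥-elim (only-check {d = d} (λ ()) inf)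

  zero-label : ∀ {c t ρ} → Run (check zero c) t ρ →
               ∀ d i → ρ (prefix d (suc i)) ≡ check zero (t (prefix d i))
  zero-label R d zero    with split R
  ... | _ , _ , check-zero , R₁ , R₂ with d 0
  ...   | l = Run.start R₁
  ...   | r = Run.start R₂
  zero-label R d (suc i) with split R
  ... | _ , _ , check-zero , R₁ , R₂ with d 0
  ...   | l = zero-label R₁ (d ∘ suc) i
  ...   | r = zero-label R₂ (d ∘ suc) i

  check-split : ∀ {j c t ρ} → Run (check (suc j) c) t ρ →
                Run (check (suc j) 0F) (child l t) (child l ρ) ×
                Run (check (inject₁ j) 0F) (child r t) (child r ρ)
  check-split R with split R
  ... | _ , _ , check-suc , R₁ , R₂ = R₁ , R₂

  check-sound : ∀ j {k c t ρ} → toℕ j ≡ k → Run (check j c) t ρ → Clean k t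
  check-sound zero {t = t} {ρ} refl R [] t∈𝓛 with d , inf ← 𝓛⇒directions {t} t∈𝓛 =
    proj₁ (proj₂ (Run.good R d)) (Inf-untail {w = ρ ∘ prefix d} λ k →
      let m , k≤m , e = inf k in m , k≤m , trans (zero-label R d m) (cong (check zero) e))
  check-sound (suc j) e R (zero ∷ as)  =
    check-sound (inject₁ j) (trans (toℕ-inject₁ j) (ℕₚ.suc-injective e)) (proj₂ (check-split R)) as
  check-sound (suc j) e R (suc m ∷ as) = check-sound (suc j) e (proj₁ (check-split R)) (m ∷ as)

  -- Runs from `search` states

  follow : Direction → Direction → State (suc n) → State (suc n)
  follow l l q = q
  follow r r q = q
  follow _ _ _ = any

  follow-refl : ∀ e {q} → follow e e q ≡ q
  follow-refl l = refl
  follow-refl r = refl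

  follow-search : ∀ e e′ {q c} → follow e e′ q ≡ search c → e ≡ e′ × q ≡ search c
  follow-search l l p = refl , p
  follow-search r r p = refl , p

  trace : Fin 2 → Tree (Fin 2) → (ℕ → Direction) → Tree (State (suc n))
  trace c t d []      = search c
  trace c t d (e ∷ u) = follow (d 0) e (trace (t []) (child e t) (d ∘ suc) u)

  trace-step : ∀ c t d u → Step (trace c t d u) (t u) (trace c t d (u ∷ʳ l)) (trace c t d (u ∷ʳ r))
  trace-step c t d [] with d 0
  ... | l = search-l
  ... | r = search-r
  trace-step c t d (e ∷ u) with d 0 | e
  ... | l | l = trace-step (t []) (child l t) (d ∘ suc) u
  ... | r | r = trace-step (t []) (child r t) (d ∘ suc) u
  ... | l | r = any-any
  ... | r | l = any-any

  trace-search-or-any : ∀ c t d u → (∃[ c′ ] trace c t d u ≡ search c′) ⊎ trace c t d u ≡ any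
  trace-search-or-any c t d []      = inj₁ (c , refl)
  trace-search-or-any c t d (e ∷ u) with d 0 | e
  ... | l | l = trace-search-or-any (t []) (child l t) (d ∘ suc) u
  ... | r | r = trace-search-or-any (t []) (child r t) (d ∘ suc) u
  ... | l | r = inj₂ refl
  ... | r | l = inj₂ refl

  trace-agree : ∀ m {c t d d′ c′} → trace c t d (prefix d′ m) ≡ search c′ → Agree m d d′
  trace-agree (suc m) {d = d} {d′} p i i<m with follow-search (d 0) (d′ 0) p
  trace-agree (suc m) p zero    _         | q , _ = q
  trace-agree (suc m) {d = d} {d′} p (suc i) (s≤s i<m) | _ , p′ =
    trace-agree m {d = d ∘ suc} {d′ ∘ suc} p′ i i<m

  trace-label : ∀ i {c t d d′} → (∀ j → d j ≡ d′ j) →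
                trace c t d (prefix d′ (suc i)) ≡ search (t (prefix d′ i))
  trace-label zero    {d = d} {d′} h rewrite h 0 = follow-refl (d′ 0)
  trace-label (suc i) {c} {t} {d} {d′} h rewrite h 0 =
    trans (follow-refl (d′ 0)) (trace-label i {t []} {child (d′ 0) t} (h ∘ suc))

  search-complete : ∀ c t → 𝓛 t → AcceptedFrom (search c) t
  search-complete c t t∈𝓛 with d , inf ← 𝓛⇒directions {t} t∈𝓛 = trace c t d , record
    { start = refl ; step = trace-step c t d ; good = good }
    where
    good : ∀ d′ → Good (trace c t d ∘ prefix d′)
    good d′ = (λ j → avoid λ { (inj₁ (_ , ())) ; (inj₂ ()) }) ,
              avoid (λ { (inj₁ (_ , ())) ; (inj₂ ()) }) ,
              -- If `search 0F` recurs along d′, then d′ never leaves d, so the letters recorded on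
              -- it contain infinitely many 1s.
              λ inf₀ → Inf-untail {w = trace c t d ∘ prefix d′} λ k →
                let d≗d′ : ∀ j → d j ≡ d′ j
                    d≗d′ j = let m , j<m , e = inf₀ (suc j) in trace-agree m {c} {t} {d} {d′} e j j<m
                    m , k≤m , e = inf k
                in m , k≤m , trans (trace-label m {c} {t} d≗d′)
                     (cong search (trans (cong t (sym (prefix-cong m λ j _ → d≗d′ j))) e))
      where
      avoid : ∀ {q} → ¬ ((∃[ c′ ] q ≡ search c′) ⊎ q ≡ any) → ¬ Inf q (trace c t d ∘ prefix d′)
      avoid h inf′ with m , _ , e ← inf′ 0 =
        h (subst (λ q → (∃[ c′ ] q ≡ search c′) ⊎ q ≡ any) e
             (trace-search-or-any c t d (prefix d′ m)))

  descend : ∀ {c t ρ} → Run (search c) t ρ → ∃[ e ] Run (search (t [])) (child e t) (child e ρ)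
  descend R with split R
  ... | _ , _ , search-l , R₁ , _ = l , R₁
  ... | _ , _ , search-r , _ , R₂ = r , R₂

  branch : ∀ {c t ρ} → Run (search c) t ρ → ℕ → Direction
  branch R zero    = proj₁ (descend R)
  branch R (suc i) = branch (proj₂ (descend R)) i

  branch-label : ∀ {c t ρ} (R : Run (search c) t ρ) i →
                 ρ (prefix (branch R) (suc i)) ≡ search (t (prefix (branch R) i))
  branch-label R zero    = Run.start (proj₂ (descend R))
  branch-label R (suc i) = branch-label (proj₂ (descend R)) i

  -- Runs from `main` states

  main-complete : ∀ j {k p t} → toℕ j ≡ k → (a : Vec ℕ (suc k)) →
                  𝓛 (subtree t (address a)) → OddFrom p a →
                  (∀ b → b <ₗ a → ¬ 𝓛 (subtree t (address b))) → AcceptedFrom (main j p) t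
  main-complete j {t = t} refl (suc m ∷ as) t∈𝓛 odd least =
    join main-l
      (main-complete j refl (m ∷ as) t∈𝓛 odd λ
        { (m′ ∷ bs) (here p)  → least (suc m′ ∷ bs) (here (s≤s p))
        ; (m′ ∷ bs) (there p) → least (suc m′ ∷ bs) (there p) })
      (check-complete j 0F (child r t) refl λ bs → least (0 ∷ bs) (here (s≤s z≤n)))
  main-complete zero {p = true} {t} refl (zero ∷ []) t∈𝓛 odd least =
    join main-search (any-accepts _) (search-complete 0F (child r t) t∈𝓛)
  main-complete (suc j) {t = t} refl (zero ∷ as@(_ ∷ _)) t∈𝓛 odd least =
    join main-r (any-accepts _)
      (main-complete (inject₁ j) (toℕ-inject₁ j) as t∈𝓛 odd
        λ bs p → least (0 ∷ bs) (there p))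

  module _ (em : ExcludedMiddle 0ℓ) where
    open Classical em

    -- With only finitely many 1s on the chosen branch, `search 0F` would recur, and acceptance
    -- would then make `search 1F` recur as well.
    search-sound : ∀ {c t ρ} → Run (search c) t ρ → 𝓛 t
    search-sound {c} {t} {ρ} R = directions⇒𝓛 {t} d (dne λ ¬inf →
      ¬inf λ k → let m , k≤m , e = Inf-tail {w = w} (proj₂ (proj₂ (Run.good R d)) (zeros ¬inf)) k
                 in m , k≤m , search-injective (trans (sym (branch-label R m)) e))
      where
      d = branch R
      w = ρ ∘ prefix d
      zeros : ¬ Inf 1F (t ∘ prefix d) → Inf (search 0F) w
      zeros ¬inf with k , finite ← ¬∀⇒∃¬ ¬inf = Inf-untail {w = w} λ k′ →
        k ℕ.+ k′ , ℕₚ.m≤n+m k′ k , trans (branch-label R (k ℕ.+ k′))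
          (cong search (label (t (prefix d (k ℕ.+ k′)))
            λ e → finite (k ℕ.+ k′ , ℕₚ.m≤m+n k k′ , e)))
        where
        label : ∀ (c : Fin 2) → ¬ c ≡ 1F → c ≡ 0F
        label 0F _ = refl
        label 1F h = contradiction refl h

    leftmost : ℕ → Node
    leftmost = prefix (λ _ → l)

    -- A run guessing l forever would alternate parities on the leftmost branch, so `main j true`
    -- would recur there, against acceptance.
    main-sound : ∀ k j {p t ρ} → toℕ j ≡ k → Run (main j p) t ρ → First k p t
    -- No bound on the block length is known beforehand, so i limits the search. Two consecutive
    -- states are returned because one of them has parity `true`.
    first-or-stay : ∀ i k j {p t ρ} → toℕ j ≡ k → Run (main j p) t ρ →
      First k p t ⊎ (∃[ b ] (ρ (leftmost i) ≡ main j b × ρ (leftmost (suc i)) ≡ main j (not b)))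

    first-or-stay i k j {t = t} e R with split R
    first-or-stay i       (suc k) (suc j) {t = t} e R | _ , _ , main-r , _ , R₂ =
      inj₁ (First-r {t = t} (main-sound k (inject₁ j) (trans (toℕ-inject₁ j) (ℕₚ.suc-injective e)) R₂))
    first-or-stay i       zero    zero    {t = t} e R | _ , _ , main-search , _ , R₂ =
      inj₁ (First-zero {t} (search-sound R₂))
    first-or-stay zero    k       j               e R | _ , _ , main-l , R₁ , _ =
      inj₂ (_ , Run.start R , Run.start R₁)
    first-or-stay (suc i) k       j       {t = t} e R | _ , _ , main-l , R₁ , R₂ =
      map₁ (First-l {t = t} (check-sound j e R₂)) (first-or-stay i k j e R₁)

    main-sound k j {p} {t} {ρ} e R = dne λ ¬first →
      proj₁ (Run.good R (λ _ → l)) j λ i →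
        [ (λ f → contradiction f ¬first) , recurs i ]′ (first-or-stay i k j e R)
      where
      recurs : ∀ i → (∃[ b ] (ρ (leftmost i) ≡ main j b × ρ (leftmost (suc i)) ≡ main j (not b))) →
               ∃[ m ] (i ℕ.≤ m × ρ (leftmost m) ≡ main j true)
      recurs i (true  , e , _) = i , ℕₚ.≤-refl , e
      recurs i (false , _ , e) = suc i , ℕₚ.n≤1+n i , e

-- The Muller automaton with numbered states

module Automaton (em : ExcludedMiddle 0ℓ) (k : ℕ) where
  open Classical em

  open Inverse (State↔Fin (suc k)) using (to; from; strictlyInverseˡ; strictlyInverseʳ)

  automaton : MullerAutomaton 2
  automaton = record
    { states = size (suc k)
    ; Δ      = λ i c i₁ i₂ → isYes (em {Step (to i) c (to i₁) (to i₂)})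
    -- All k + 1 blocks are still to be read, and the first has even length so far.
    ; q₀     = from (main (fromℕF k) false)
    ; 𝓕      = λ S → isYes (em {GoodSet (λ q → from q ∈ S)})
    }

  open MullerAutomaton automaton using (Accepts)

  Inf-from : ∀ {q} {w : ℕ → Fin (size (suc k))} → Inf (from q) w ⇔ Inf q (to ∘ w)
  Inf-from {q} {w} = mk⇔
    (λ (inf : Inf (from q) w) n → let m , n≤m , e = inf n in
      m , n≤m , trans (cong to e) (strictlyInverseˡ q))
    (λ (inf : Inf q (to ∘ w)) n → let m , n≤m , e = inf n in
      m , n≤m , trans (sym (strictlyInverseʳ _)) (cong from e))

  Accepts⇒AcceptedFrom : ∀ {t} → Accepts t → AcceptedFrom (main (fromℕF k) false) t
  Accepts⇒AcceptedFrom {t} (ρ , (start , step) , accepting) = to ∘ ρ , record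
    { start = trans (cong to start) (strictlyInverseˡ _)
    ; step  = λ u → toWitness {a? = em} (step u)
    ; good  = λ d → let S , iff , S∈𝓕 = accepting (toBranch d) in
        GoodSet-resp (λ q → Inf-from {q} {ρ ∘ prefix d} ⇔-∘ iff (from q))
                     (toWitness {a? = em} S∈𝓕)
    }

  infinitySet : ∀ {N} → (ℕ → Fin N) → Subset N
  infinitySet w = tabulate λ i → isYes (em {Inf i w})

  ∈-infinitySet : ∀ {N} (w : ℕ → Fin N) i → i ∈ infinitySet w ⇔ Inf i w
  ∈-infinitySet w i = mk⇔
    (λ i∈ → toWitness {a? = em} (Equivalence.from T-≡
      (trans (sym (lookup∘tabulate _ i)) ([]=⇒lookup i∈))))
    (λ inf → lookup⇒[]= i _ (trans (lookup∘tabulate _ i)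
      (Equivalence.to T-≡ (fromWitness {a? = em} inf))))

  AcceptedFrom⇒Accepts : ∀ {t} → AcceptedFrom (main (fromℕF k) false) t → Accepts t
  AcceptedFrom⇒Accepts {t} (ρ , R) = from ∘ ρ ,
    (cong from (Run.start R) ,
     λ u → fromWitness {a? = em} (to-step (Run.step R u))) ,
    accepting
    where
    to-step : ∀ {q c q₁ q₂} → Step q c q₁ q₂ →
              Step (to (from q)) c (to (from q₁)) (to (from q₂))
    to-step {q} {c} {q₁} {q₂} s
      rewrite strictlyInverseˡ q | strictlyInverseˡ q₁ | strictlyInverseˡ q₂ = s
    accepting : MullerAutomaton.IsAccepting automaton (from ∘ ρ)
    accepting b = infinitySet w , ∈-infinitySet w , fromWitness {a? = em}
      (GoodSet-resp (λ q → ⇔-sym (∈-infinitySet w (from q)) ⇔-∘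
                             (⇔-sym (Inf-from {q} {w}) ⇔-∘
                              mk⇔ (Inf-cong label) (Inf-cong (sym ∘ label))))
                    (Run.good R d))
      where
      w = path (from ∘ ρ) b
      d = proj₁ (fromBranch b)
      label : ∀ i → ρ (prefix d i) ≡ to (w i)
      label i = sym (trans (strictlyInverseˡ _) (cong ρ (proj₂ (fromBranch b) i)))

  First⇔𝓛Ord : ∀ {t} → First k false t ⇔ 𝓛Ord k t
  First⇔𝓛Ord = mk⇔
    (λ (a , t∈𝓛 , odd , least) →
      a , (t∈𝓛 , 2∤last⇒Odd-Ord a (Equivalence.to (OddFrom⇔2∤last a) odd)) ,
      λ b p → least b (Ord-cancel-< p))
    (λ (a , (t∈𝓛 , odd) , least) →
      a , t∈𝓛 , Equivalence.from (OddFrom⇔2∤last a) (Odd-Ord⇒2∤last a odd) ,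
      λ b p → least b (Ord-mono-< p))

  𝓛Ord-recognizable : MullerRecognizable 2 (𝓛Ord k)
  𝓛Ord-recognizable = automaton ,
    (λ {t} t∈ → let a , t∈𝓛 , odd , least = Equivalence.from (First⇔𝓛Ord {t}) t∈ in
      AcceptedFrom⇒Accepts (main-complete (fromℕF k) (toℕ-fromℕ k) a t∈𝓛 odd least)) ,
    λ {t} acc → Equivalence.to (First⇔𝓛Ord {t})
      (main-sound em k (fromℕF k) (toℕ-fromℕ k) (proj₂ (Accepts⇒AcceptedFrom acc)))

theorem4p6 : ExcludedMiddle 0ℓ →
    (n : ℕ) .{{_ : NonZero n}} →
    DΣ¹₁-Complete (ω^ n) (Trees (Fin 2)) (𝓛ₙ n) × MullerRecognizable 2 (𝓛ₙ n)
theorem4p6 em (suc k) = 𝓛ₙ-complete k , automaton , ≐-trans (𝓛ₙ≐𝓛Ord k) (proj₂ 𝓛Ord-recognizable)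
  where
  open Completeness em
  open Automaton em k
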